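{- Let $q$ be a prime power and let $k \ge 3$ be an integer. For $B \in \mathbb{F}_{q^k}^{\times}$ let $F_B(X) = X^{q+1} - BX + B \in \mathbb{F}_{q^k}[X]$. Define polynomials $P_i(X) \in \mathbb{F}_q[X]$ by $P_1(X) = 1$, $P_2(X) = 1$, and for $i \ge 3$, \[ P_i(X) = P_{i-1}(X) - X^{q^{i-3}} P_{i-2}(X). \] Then for every $B \in \mathbb{F}_{q^k}^{\times}$, the polynomial $F_B(X)$ splits completely over $\mathbb{F}_{q^k}$ (i.e., factors into a product of $q+1$ linear polynomials in $\mathbb{F}_{q^k}[X]$) if and only if $P_k\!\left(\frac{1}{B}\right) = 0$.
   Context: An element $B \in \mathbb{F}_{q^k}^{\times}$ for which $X^{q+1} - BX + B$ splits completely over $\mathbb{F}_{q^k}$ is called a Bluher value; the theorem characterises Bluher values as the inverses of the roots of $P_k$ in $\mathbb{F}_{q^k}^{\times}$. -}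

module Defs where

open import Level using (_⊔_)
open import Data.Nat as ℕ using (ℕ; zero; suc; _≡ᵇ_)
open import Data.Bool using (if_then_else_)
open import Data.Fin using (Fin)
open import Data.List using (List; []; _∷_; length)
open import Data.Product using (Σ; ∃; _×_)
open import Relation.Nullary using (¬_)
open import Relation.Binary.PropositionalEquality as ≡ using (_≡_)
open import Function.Bundles using (Inverse)
open import Algebra.Bundles using (CommutativeRing)

record IsField {c ℓ} (F : CommutativeRing c ℓ) : Set (c ⊔ ℓ) where
  open CommutativeRing F hiding (zero)
  field
    1≉0     : ¬ (1# ≈ 0#)
    inverse : ∀ x → ¬ (x ≈ 0#) → ∃ λ y → x * y ≈ 1#

HasOrder : ∀ {c ℓ} → CommutativeRing c ℓ → ℕ → Set (c ⊔ ℓ)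
HasOrder F n = Inverse (CommutativeRing.setoid F) (≡.setoid (Fin n))

module Poly {c ℓ} (F : CommutativeRing c ℓ) where
  open CommutativeRing F hiding (zero)

  pow : Carrier → ℕ → Carrier
  pow x zero    = 1#
  pow x (suc n) = x * pow x n

  -- Polynomials are represented by coefficient sequences ℕ → Carrier
  -- (coefficient of X^n at index n).

  -- coefficients of ∏_{r ∈ rs} (X - r)
  linProd : List Carrier → ℕ → Carrier
  linProd []       zero    = 1#
  linProd []       (suc n) = 0#
  linProd (r ∷ rs) zero    = - (r * linProd rs zero)
  linProd (r ∷ rs) (suc n) = linProd rs n - r * linProd rs (suc n)

  -- coefficients of F_B(X) = X^(q+1) - B X + B   (assumes q ≥ 2)
  FB : ℕ → Carrier → ℕ → Carrier
  FB q B zero          = B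
  FB q B (suc zero)    = - B
  FB q B (suc (suc n)) = if suc (suc n) ≡ᵇ suc q then 1# else 0#

  -- a polynomial of degree d (given by coefficients f) splits completely:
  -- it equals a product of d monic linear factors X - r_i  (f monic here)
  SplitsCompletely : ℕ → (ℕ → Carrier) → Set (c ⊔ ℓ)
  SplitsCompletely d f =
    Σ (List Carrier) λ rs → (length rs ≡ d) × (∀ n → linProd rs n ≈ f n)

  -- evaluation at x of P_i ∈ F_q[X]:  P_1 = P_2 = 1,
  -- P_i = P_{i-1} - X^(q^(i-3)) P_{i-2}  for i ≥ 3.  (P_0 unused, set to 1.)
  P : ℕ → ℕ → Carrier → Carrier
  P q zero                x = 1#
  P q (suc zero)          x = 1#
  P q (suc (suc zero))    x = 1#
  P q (suc (suc (suc i))) x =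
    P q (suc (suc i)) x - pow x (q ℕ.^ i) * P q (suc i) x

{-# OPTIONS --safe #-}

-- Let s be a solution of s(n+q+1) = B s(n+1) - B s(n), for instance s(n) = r^n with
-- r a root of F_B, or the impulse response with initial values 0, ..., 0, 1.
-- Applying Frobenius to this recurrence and iterating gives
--   γ_i s(n+1+q^i) + δ_i s(n+q^i) = γ_(i+1) s(n+1) + δ_(i+1) s(n),
-- where γ and δ are continuants in the powers B^(q^j), and γ_k is P_k(1/B) up to a
-- unit. If F_B splits, its roots are simple, and as r^(q^k) = r they are q+1 ≥ 3 roots
-- of γ_k X² + (δ_k - γ_(k+1)) X - δ_(k+1); hence γ_k = 0. Conversely, if γ_k = 0, then
-- δ_(k+1) = 0 and δ_k = γ_(k+1) ≠ 0, so s(n+q^k) = s(n+1) for every solution s. As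
-- X^(q^k) - X = ∏_a (X - a), the product of all T - a, with T the shift operator,
-- kills the impulse response, and so does the product over the roots of F_B, since
-- T - a is injective on solutions when a is not a root. The impulse response has q
-- leading zeros, so F_B has more than q roots.
module Submission where

open import Defs
open import Level using (_⊔_)
open import Data.Bool using (true; false; if_then_else_)
open import Data.Fin.Base as Fin using (Fin; punchIn)
open import Data.Fin.Permutation using (Permutation′; permutation)
import Data.Fin.Properties as Finₚ
open import Data.List.Base using (List; []; _∷_; length; tabulate; filter; take)
import Data.List.Properties as List
open import Data.List.Relation.Unary.All as All using (All; []; _∷_)
import Data.List.Relation.Unary.All.Properties as All
open import Data.List.Relation.Unary.AllPairs using ([]; _∷_)
open import Data.List.Relation.Unary.Any using (Any; here; there)
open import Data.List.Relation.Unary.Unique.Setoid using (Unique)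
import Data.List.Relation.Unary.Unique.Setoid.Properties as Unique
open import Data.Maybe.Base using (Maybe; just; nothing)
open import Data.Nat as ℕ using (ℕ; zero; suc; _≤_; _<_; _∸_; _^_; _≡ᵇ_; z≤n; s≤s)
open import Data.Nat.Combinatorics using (_C_; nCn≡1; nC1≡n; nCk≡nC[n∸k]; k>n⇒nCk≡0; nCk+nC[k+1]≡[n+1]C[k+1])
open import Data.Nat.Divisibility using (_∣_; divides; >⇒∤; m∣m*n)
open import Data.Nat.Primality using (Prime; euclidsLemma; prime⇒nonZero; prime⇒nonTrivial)
import Data.Nat.Properties as ℕₚ
open import Data.Product using (∃; _×_; _,_; proj₁; proj₂)
open import Data.Product.Properties using (≡-dec)
open import Data.Sum using (inj₁; inj₂)
open import Data.Vec.Functional using (Vector)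
open import Function.Base using (_∘_)
open import Function.Bundles using (Inverse; _⇔_; mk⇔)
open import Function.Definitions using (Congruent)
open import Relation.Nullary using (¬_; yes; no; contradiction)
open import Relation.Nullary.Decidable using (map′)
import Relation.Unary as U
open import Relation.Binary.Definitions using (Decidable)
open import Relation.Binary.PropositionalEquality as ≡ using (_≡_; _≢_)
import Relation.Binary.Reasoning.Setoid as SetoidReasoning
open import Algebra.Bundles using (CommutativeMonoid; CommutativeRing; RawRing)
import Algebra.Properties.AbelianGroup as AbelianGroupProperties
import Algebra.Properties.CommutativeMonoid.Sum as Sum
import Algebra.Properties.CommutativeSemiring.Exp as Exponents
import Algebra.Properties.Group as GroupProperties
import Algebra.Properties.Ring as RingProperties
import Algebra.Properties.Semiring.Mult as Multiples
import Algebra.Properties.Semiring.Mult.TCOptimised as OptimisedMultiples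
import Algebra.Solver.Ring as RingSolver
open import Algebra.Solver.Ring.AlmostCommutativeRing using (_-Raw-AlmostCommutative⟶_; fromCommutativeRing)
import Algebra.Solver.Ring.NaturalCoefficients.Default as SemiringSolver

-- A ring solver with integer coefficients, represented as formal differences
-- (a , b) of natural numbers, one of which is zero after each operation.
module Solver {c ℓ} (R : CommutativeRing c ℓ) where
  open CommutativeRing R hiding (zero)
  open RingProperties ring using (-‿distribˡ-*; -‿distribʳ-*; -0#≈0#; -‿involutive)
  open AbelianGroupProperties +-abelianGroup using (⁻¹-∙-comm)
  open OptimisedMultiples semiring renaming (_×_ to _×′_)
  open SetoidReasoning setoid
  module SR = SemiringSolver commutativeSemiring

  cancel : ℕ → ℕ → ℕ × ℕ
  cancel zero    n       = zero , n
  cancel (suc m) zero    = suc m , zero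
  cancel (suc m) (suc n) = cancel m n

  differences : RawRing _ _
  differences = record
    { Carrier = ℕ × ℕ
    ; _≈_     = _≡_
    ; _+_     = λ (a , b) (c , d) → cancel (a ℕ.+ c) (b ℕ.+ d)
    ; _*_     = λ (a , b) (c , d) → cancel (a ℕ.* c ℕ.+ b ℕ.* d) (a ℕ.* d ℕ.+ b ℕ.* c)
    ; -_      = λ (a , b) → b , a
    ; 0#      = 0 , 0
    ; 1#      = 1 , 0
    }

  -- The case split makes `(0 , 0)` and `(1 , 0)` evaluate to `0#` and `1#` by computation, so that
  -- `:0` and `:1` match these constants in goals.
  value : ℕ × ℕ → Carrier
  value (a , zero)  = a ×′ 1#
  value (a , suc b) = a ×′ 1# - suc b ×′ 1#

  value-difference : ∀ a b → value (a , b) ≈ a ×′ 1# - b ×′ 1#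
  value-difference a zero    = sym (trans (+-congˡ -0#≈0#) (+-identityʳ _))
  value-difference a (suc b) = refl

  value-cancel : ∀ a b → value (cancel a b) ≈ a ×′ 1# - b ×′ 1#
  value-cancel zero    b       = value-difference zero b
  value-cancel (suc a) zero    = value-difference (suc a) zero
  value-cancel (suc a) (suc b) = begin
    value (cancel a b)                              ≈⟨ value-cancel a b ⟩
    a ×′ 1# - b ×′ 1#                               ≈⟨ +-identityˡ _ ⟨
    0# + (a ×′ 1# - b ×′ 1#)                        ≈⟨ +-congʳ (-‿inverseʳ 1#) ⟨
    (1# - 1#) + (a ×′ 1# - b ×′ 1#)                 ≈⟨ SR.solve 4 (λ x y z w → ((x :+ y) :+ (z :+ w)) := ((x :+ z) :+ (y :+ w))) refl 1# (- 1#) (a ×′ 1#) (- (b ×′ 1#)) ⟩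
    (1# + a ×′ 1#) + (- 1# + - (b ×′ 1#))           ≈⟨ +-congˡ (⁻¹-∙-comm 1# (b ×′ 1#)) ⟩
    (1# + a ×′ 1#) - (1# + b ×′ 1#)                 ≈⟨ +-cong (1+× a 1#) (-‿cong (1+× b 1#)) ⟨
    suc a ×′ 1# - suc b ×′ 1#                       ∎
    where
    open SR using (_:+_; _:=_)

  homomorphism : differences -Raw-AlmostCommutative⟶ fromCommutativeRing R
  homomorphism = record
    { ⟦_⟧    = value
    ; +-homo = λ (a , b) (c , d) → begin
        value (cancel (a ℕ.+ c) (b ℕ.+ d))
          ≈⟨ value-cancel (a ℕ.+ c) (b ℕ.+ d) ⟩
        (a ℕ.+ c) ×′ 1# - (b ℕ.+ d) ×′ 1#
          ≈⟨ +-cong (×-homo-+ 1# a c) (-‿cong (×-homo-+ 1# b d)) ⟩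
        (⌜ a ⌝ + ⌜ c ⌝) - (⌜ b ⌝ + ⌜ d ⌝)
          ≈⟨ +-congˡ (⁻¹-∙-comm ⌜ b ⌝ ⌜ d ⌝) ⟨
        (⌜ a ⌝ + ⌜ c ⌝) + (- ⌜ b ⌝ + - ⌜ d ⌝)
          ≈⟨ SR.solve 4 (λ x y z w → ((x :+ y) :+ (z :+ w)) := ((x :+ z) :+ (y :+ w))) refl ⌜ a ⌝ ⌜ c ⌝ (- ⌜ b ⌝) (- ⌜ d ⌝) ⟩
        (⌜ a ⌝ - ⌜ b ⌝) + (⌜ c ⌝ - ⌜ d ⌝)
          ≈⟨ +-cong (value-difference a b) (value-difference c d) ⟨
        value (a , b) + value (c , d) ∎
    ; *-homo = λ (a , b) (c , d) → begin
        value (cancel (a ℕ.* c ℕ.+ b ℕ.* d) (a ℕ.* d ℕ.+ b ℕ.* c))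
          ≈⟨ value-cancel (a ℕ.* c ℕ.+ b ℕ.* d) (a ℕ.* d ℕ.+ b ℕ.* c) ⟩
        ⌜ a ℕ.* c ℕ.+ b ℕ.* d ⌝ - ⌜ a ℕ.* d ℕ.+ b ℕ.* c ⌝
          ≈⟨ +-cong (cross a c b d) (-‿cong (cross a d b c)) ⟩
        (⌜ a ⌝ * ⌜ c ⌝ + ⌜ b ⌝ * ⌜ d ⌝) - (⌜ a ⌝ * ⌜ d ⌝ + ⌜ b ⌝ * ⌜ c ⌝)
          ≈⟨ +-cong (+-congˡ (neg*neg ⌜ b ⌝ ⌜ d ⌝)) (⁻¹-∙-comm _ _) ⟨
        (⌜ a ⌝ * ⌜ c ⌝ + - ⌜ b ⌝ * - ⌜ d ⌝) + (- (⌜ a ⌝ * ⌜ d ⌝) + - (⌜ b ⌝ * ⌜ c ⌝))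
          ≈⟨ +-congˡ (+-cong (-‿distribʳ-* ⌜ a ⌝ ⌜ d ⌝) (-‿distribˡ-* ⌜ b ⌝ ⌜ c ⌝)) ⟩
        (⌜ a ⌝ * ⌜ c ⌝ + - ⌜ b ⌝ * - ⌜ d ⌝) + (⌜ a ⌝ * - ⌜ d ⌝ + - ⌜ b ⌝ * ⌜ c ⌝)
          ≈⟨ SR.solve 4 (λ x y z w → ((x :* y :+ z :* w) :+ (x :* w :+ z :* y)) := ((x :+ z) :* (y :+ w))) refl ⌜ a ⌝ ⌜ c ⌝ (- ⌜ b ⌝) (- ⌜ d ⌝) ⟩
        (⌜ a ⌝ - ⌜ b ⌝) * (⌜ c ⌝ - ⌜ d ⌝)
          ≈⟨ *-cong (value-difference a b) (value-difference c d) ⟨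
        value (a , b) * value (c , d) ∎
    ; -‿homo = λ (a , b) → begin
        value (b , a)          ≈⟨ value-difference b a ⟩
        ⌜ b ⌝ - ⌜ a ⌝          ≈⟨ +-congʳ (-‿involutive ⌜ b ⌝) ⟨
        - - ⌜ b ⌝ - ⌜ a ⌝      ≈⟨ ⁻¹-∙-comm _ _ ⟩
        - (- ⌜ b ⌝ + ⌜ a ⌝)    ≈⟨ -‿cong (+-comm _ _) ⟩
        - (⌜ a ⌝ - ⌜ b ⌝)      ≈⟨ -‿cong (value-difference a b) ⟨
        - value (a , b)        ∎
    ; 0-homo = refl
    ; 1-homo = refl
    }
    where
    open SR using (_:+_; _:*_; _:=_)
    ⌜_⌝ : ℕ → Carrier
    ⌜ n ⌝ = n ×′ 1#
    cross : ∀ a c b d → ⌜ a ℕ.* c ℕ.+ b ℕ.* d ⌝ ≈ ⌜ a ⌝ * ⌜ c ⌝ + ⌜ b ⌝ * ⌜ d ⌝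
    cross a c b d = trans (×-homo-+ 1# (a ℕ.* c) (b ℕ.* d)) (+-cong (×1-homo-* a c) (×1-homo-* b d))
    neg*neg : ∀ x y → - x * - y ≈ x * y
    neg*neg x y = trans (sym (-‿distribˡ-* x (- y)))
      (trans (-‿cong (sym (-‿distribʳ-* x y))) (-‿involutive (x * y)))

  value-≟ : ∀ x y → Maybe (value x ≈ value y)
  value-≟ x y with ≡-dec ℕₚ._≟_ ℕₚ._≟_ x y
  ... | yes x≡y = just (reflexive (≡.cong value x≡y))
  ... | no  _   = nothing

  open RingSolver differences (fromCommutativeRing R) homomorphism value-≟ public

  :0 :1 : ∀ {n} → Polynomial n
  :0 = con (0 , 0)
  :1 = con (1 , 0)

-- Binomial coefficients modulo a prime

nC0≡1 : ∀ n → n C 0 ≡ 1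
nC0≡1 n = ≡.trans (nCk≡nC[n∸k] (z≤n {n})) (nCn≡1 n)

-- The absorption identity, by induction on `n`: Pascal's rule splits the coefficient on the left
-- and recombines the two instances of the induction hypothesis.
[k+1]*[n+1]C[k+1]≡[n+1]*nCk : ∀ n k → suc k ℕ.* (suc n C suc k) ≡ suc n ℕ.* (n C k)
[k+1]*[n+1]C[k+1]≡[n+1]*nCk zero    zero    = ≡.refl
[k+1]*[n+1]C[k+1]≡[n+1]*nCk zero    (suc k) =
  ≡.trans (≡.cong (suc (suc k) ℕ.*_) (k>n⇒nCk≡0 {1} {suc (suc k)} (s≤s (s≤s z≤n))))
    (≡.trans (ℕₚ.*-zeroʳ (suc (suc k))) (≡.sym (≡.cong (1 ℕ.*_) (k>n⇒nCk≡0 {0} {suc k} (s≤s z≤n)))))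
[k+1]*[n+1]C[k+1]≡[n+1]*nCk (suc n) zero    = begin
  1 ℕ.* (suc (suc n) C 1)       ≡⟨ ℕₚ.*-identityˡ _ ⟩
  suc (suc n) C 1               ≡⟨ nC1≡n (suc (suc n)) ⟩
  suc (suc n)                   ≡⟨ ℕₚ.*-identityʳ _ ⟨
  suc (suc n) ℕ.* 1             ≡⟨ ≡.cong (suc (suc n) ℕ.*_) (nC0≡1 (suc n)) ⟨
  suc (suc n) ℕ.* (suc n C 0)   ∎
  where open ≡.≡-Reasoning
[k+1]*[n+1]C[k+1]≡[n+1]*nCk (suc n) (suc k) = begin
  suc (suc k) ℕ.* (suc (suc n) C suc (suc k))
    ≡⟨ ≡.cong (suc (suc k) ℕ.*_) (nCk+nC[k+1]≡[n+1]C[k+1] (suc n) (suc k)) ⟨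
  suc (suc k) ℕ.* (x ℕ.+ (suc n C suc (suc k)))
    ≡⟨ ℕₚ.*-distribˡ-+ (suc (suc k)) x _ ⟩
  suc (suc k) ℕ.* x ℕ.+ suc (suc k) ℕ.* (suc n C suc (suc k))
    ≡⟨ ≡.cong₂ (λ a b → x ℕ.+ a ℕ.+ b) ([k+1]*[n+1]C[k+1]≡[n+1]*nCk n k) ([k+1]*[n+1]C[k+1]≡[n+1]*nCk n (suc k)) ⟩
  x ℕ.+ suc n ℕ.* (n C k) ℕ.+ suc n ℕ.* (n C suc k)
    ≡⟨ ℕₚ.+-assoc x _ _ ⟩
  x ℕ.+ (suc n ℕ.* (n C k) ℕ.+ suc n ℕ.* (n C suc k))
    ≡⟨ ≡.cong (x ℕ.+_) (ℕₚ.*-distribˡ-+ (suc n) (n C k) (n C suc k)) ⟨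
  x ℕ.+ suc n ℕ.* ((n C k) ℕ.+ (n C suc k))
    ≡⟨ ≡.cong (λ y → x ℕ.+ suc n ℕ.* y) (nCk+nC[k+1]≡[n+1]C[k+1] n k) ⟩
  suc (suc n) ℕ.* x ∎
  where
  open ≡.≡-Reasoning
  x = suc n C suc k

-- By absorption `p` divides `suc k` times the coefficient; as `suc k` lies strictly between 0 and
-- `p`, Euclid's lemma leaves the coefficient.
prime∣binomial : ∀ {p} k → Prime p → suc k < p → p ∣ p C suc k
prime∣binomial {suc p} k p-prime k<p
  with euclidsLemma (suc k) (suc p C suc k) p-prime
         (≡.subst (suc p ∣_) (≡.sym ([k+1]*[n+1]C[k+1]≡[n+1]*nCk p k)) (m∣m*n (p C k)))
... | inj₁ p∣k = contradiction p∣k (>⇒∤ k<p)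
... | inj₂ p∣C = p∣C

-- Polynomials in the shift operator and the Frobenius principle

module Sequences {c ℓ} (R : CommutativeRing c ℓ) where
  open CommutativeRing R hiding (zero)
  open Poly R
  open Exponents commutativeSemiring using (^-homo-*; ^-assocʳ; ^-distrib-*) renaming (_^_ to _^ᴿ_)
  open Multiples semiring renaming (_×_ to _·_)
  open Solver R using (solve; _:+_; _:*_; _:=_; :0; :1)
  open SetoidReasoning setoid

  Sequence : Set c
  Sequence = ℕ → Carrier

  pow≡^ : ∀ x n → pow x n ≡ x ^ᴿ n
  pow≡^ x zero    = ≡.refl
  pow≡^ x (suc n) = ≡.cong (x *_) (pow≡^ x n)

  pow-cong : ∀ n {x y} → x ≈ y → pow x n ≈ pow y n
  pow-cong zero    x≈y = refl
  pow-cong (suc n) x≈y = *-cong x≈y (pow-cong n x≈y)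

  pow-+ : ∀ x m n → pow x (m ℕ.+ n) ≈ pow x m * pow x n
  pow-+ x m n rewrite pow≡^ x (m ℕ.+ n) | pow≡^ x m | pow≡^ x n = ^-homo-* x m n

  pow-* : ∀ x m n → pow (pow x m) n ≈ pow x (m ℕ.* n)
  pow-* x m n rewrite pow≡^ (pow x m) n | pow≡^ x m | pow≡^ x (m ℕ.* n) = ^-assocʳ x m n

  pow-distrib-* : ∀ x y n → pow (x * y) n ≈ pow x n * pow y n
  pow-distrib-* x y n rewrite pow≡^ (x * y) n | pow≡^ x n | pow≡^ y n = ^-distrib-* x y n

  pow-1# : ∀ n → pow 1# n ≈ 1#
  pow-1# zero    = refl
  pow-1# (suc n) = trans (*-identityˡ _) (pow-1# n)

  -- Σ_{n ≤ d} f n · s n: a polynomial f of degree ≤ d, read as a polynomial in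
  -- the shift operator, applied to s and evaluated at index 0.
  pair : ℕ → Sequence → Sequence → Carrier
  pair zero    f s = f 0 * s 0
  pair (suc d) f s = f 0 * s 0 + pair d (f ∘ suc) (s ∘ suc)

  pair-cong : ∀ d {f g s t} → (∀ n → f n ≈ g n) → (∀ n → s n ≈ t n) → pair d f s ≈ pair d g t
  pair-cong zero    f≈g s≈t = *-cong (f≈g 0) (s≈t 0)
  pair-cong (suc d) f≈g s≈t =
    +-cong (*-cong (f≈g 0) (s≈t 0)) (pair-cong d (f≈g ∘ suc) (s≈t ∘ suc))

  pair-comm : ∀ d f s → pair d f s ≈ pair d s f
  pair-comm zero    f s = *-comm _ _
  pair-comm (suc d) f s = +-cong (*-comm _ _) (pair-comm d _ _)

  pair-last : ∀ d f s → pair (suc d) f s ≈ pair d f s + f (suc d) * s (suc d)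
  pair-last zero    f s = refl
  pair-last (suc d) f s = trans (+-congˡ (pair-last d _ _)) (sym (+-assoc _ _ _))

  pair-linearˡ : ∀ d α γ f g s →
    pair d (λ n → α * f n + γ * g n) s ≈ α * pair d f s + γ * pair d g s
  pair-linearˡ zero α γ f g s =
    solve 5 (λ α γ a b x → (α :* a :+ γ :* b) :* x := α :* (a :* x) :+ γ :* (b :* x))
      refl α γ (f 0) (g 0) (s 0)
  pair-linearˡ (suc d) α γ f g s = trans (+-congˡ (pair-linearˡ d α γ _ _ _))
    (solve 7 (λ α γ a b x y z → (α :* a :+ γ :* b) :* x :+ (α :* y :+ γ :* z)
        := α :* (a :* x :+ y) :+ γ :* (b :* x :+ z))
      refl α γ (f 0) (g 0) (s 0) _ _)

  pair-linearʳ : ∀ d α γ f s t →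
    pair d f (λ n → α * s n + γ * t n) ≈ α * pair d f s + γ * pair d f t
  pair-linearʳ d α γ f s t = begin
    pair d f (λ n → α * s n + γ * t n)  ≈⟨ pair-comm d f _ ⟩
    pair d (λ n → α * s n + γ * t n) f  ≈⟨ pair-linearˡ d α γ s t f ⟩
    α * pair d s f + γ * pair d t f
      ≈⟨ +-cong (*-congˡ (pair-comm d s f)) (*-congˡ (pair-comm d t f)) ⟩
    α * pair d f s + γ * pair d f t     ∎

  pair-top : ∀ d f s → (∀ n → n < d → f n ≈ 0#) → pair d f s ≈ f d * s d
  pair-top zero    f s low = refl
  pair-top (suc d) f s low = begin
    f 0 * s 0 + pair d (f ∘ suc) (s ∘ suc)
      ≈⟨ +-cong (*-congʳ (low 0 (s≤s z≤n))) (pair-top d _ _ (λ n n<d → low (suc n) (s≤s n<d))) ⟩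
    0# * s 0 + f (suc d) * s (suc d)
      ≈⟨ solve 2 (λ x y → :0 :* x :+ y := y) refl (s 0) _ ⟩
    f (suc d) * s (suc d) ∎

  -- Coefficients of (αX + γ) · g
  linMul : Carrier → Carrier → Sequence → Sequence
  linMul α γ g zero    = γ * g 0
  linMul α γ g (suc n) = α * g n + γ * g (suc n)

  -- The factor X acts by shifting the sequence. The vanishing of `g (suc d)` removes the one term
  -- by which `pair (suc d) g s` exceeds `pair d g s`.
  pair-linMul : ∀ d α γ g s → g (suc d) ≈ 0# →
    pair (suc d) (linMul α γ g) s ≈ α * pair d g (s ∘ suc) + γ * pair d g s
  pair-linMul d α γ g s g≈0 = begin
    γ * g 0 * s 0 + pair d (λ n → α * g n + γ * g (suc n)) (s ∘ suc)
      ≈⟨ +-congˡ (pair-linearˡ d α γ g (g ∘ suc) (s ∘ suc)) ⟩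
    γ * g 0 * s 0 + (α * pair d g (s ∘ suc) + γ * pair d (g ∘ suc) (s ∘ suc))
      ≈⟨ solve 6 (λ γ a b α x y → γ :* a :* b :+ (α :* x :+ γ :* y) := α :* x :+ γ :* (a :* b :+ y))
           refl γ (g 0) (s 0) α _ _ ⟩
    α * pair d g (s ∘ suc) + γ * pair (suc d) g s
      ≈⟨ +-congˡ (*-congˡ (begin
           pair (suc d) g s                     ≈⟨ pair-last d g s ⟩
           pair d g s + g (suc d) * s (suc d)   ≈⟨ +-congˡ (*-congʳ g≈0) ⟩
           pair d g s + 0# * s (suc d)          ≈⟨ solve 2 (λ x y → x :+ :0 :* y := x) refl _ _ ⟩
           pair d g s                           ∎)) ⟩
    α * pair d g (s ∘ suc) + γ * pair d g s ∎

  0·≈0 : ∀ {n} x → n ≡ 0 → n · x ≈ 0#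
  0·≈0 x ≡.refl = refl

  1·≈id : ∀ {n} x → n ≡ 1 → n · x ≈ x
  1·≈id x ≡.refl = ×-homo-1 x

  -- Coefficients of (αX + γ)^j
  binomial : Carrier → Carrier → ℕ → Sequence
  binomial α γ j t = (j C t) · (pow α t * pow γ (j ∸ t))

  binomial-top : ∀ α γ j → binomial α γ j (suc j) ≈ 0#
  binomial-top α γ j = 0·≈0 _ (k>n⇒nCk≡0 (ℕₚ.n<1+n j))

  binomial-suc : ∀ α γ j t → binomial α γ (suc j) t ≈ linMul α γ (binomial α γ j) t
  binomial-suc α γ j zero = begin
    (suc j C 0) · (1# * (γ * pow γ j))   ≈⟨ 1·≈id _ (nC0≡1 (suc j)) ⟩
    1# * (γ * pow γ j)
      ≈⟨ solve 2 (λ x y → :1 :* (x :* y) := x :* (:1 :* y)) refl γ _ ⟩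
    γ * (1# * pow γ j)                   ≈⟨ *-congˡ (1·≈id _ (nC0≡1 j)) ⟨
    γ * ((j C 0) · (1# * pow γ j))       ∎
  binomial-suc α γ j (suc t) = begin
    (suc j C suc t) · z                        ≈⟨ ×-congˡ {z} (≡.sym (nCk+nC[k+1]≡[n+1]C[k+1] j t)) ⟩
    ((j C t) ℕ.+ (j C suc t)) · z              ≈⟨ ×-homo-+ z (j C t) (j C suc t) ⟩
    (j C t) · z + (j C suc t) · z              ≈⟨ +-cong left right ⟩
    α * binomial α γ j t + γ * binomial α γ j (suc t) ∎
    where
    z = pow α (suc t) * pow γ (j ∸ t)
    left : (j C t) · z ≈ α * binomial α γ j t
    left = trans (×-congʳ (j C t) (*-assoc α (pow α t) _)) (sym (×-comm-* (j C t) α _))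
    right : (j C suc t) · z ≈ γ * binomial α γ j (suc t)
    -- For `t ≥ j` the truncated exponent `j ∸ suc t` is no longer one below `j ∸ t`, but then
    -- `j C suc t` is zero.
    right with suc t ℕ.≤? j
    ... | yes t<j = begin
      (j C suc t) · z
        ≈⟨ ×-congʳ (j C suc t) (*-congˡ (reflexive (≡.cong (pow γ) (ℕₚ.+-∸-assoc 1 t<j)))) ⟩
      (j C suc t) · (pow α (suc t) * (γ * pow γ (j ∸ suc t)))
        ≈⟨ ×-congʳ (j C suc t) (solve 3 (λ x y w → x :* (y :* w) := y :* (x :* w)) refl (pow α (suc t)) γ _) ⟩
      (j C suc t) · (γ * (pow α (suc t) * pow γ (j ∸ suc t)))
        ≈⟨ ×-comm-* (j C suc t) γ _ ⟨
      γ * binomial α γ j (suc t) ∎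
    ... | no  t≮j = begin
      (j C suc t) · z             ≈⟨ 0·≈0 z jC≡0 ⟩
      0#                          ≈⟨ zeroʳ γ ⟨
      γ * 0#                      ≈⟨ *-congˡ (0·≈0 _ jC≡0) ⟨
      γ * binomial α γ j (suc t)  ∎
      where jC≡0 = k>n⇒nCk≡0 (ℕₚ.≰⇒> t≮j)

  -- The binomial theorem for operators: T^(ju) = (αT^v + γ)^j on `s`, with T the shift. The
  -- induction hypothesis is taken at index `u + n`, and `rel` expands each of its terms once.
  iterate-relation : ∀ (s : Sequence) u v α γ →
    (∀ n → s (u ℕ.+ n) ≈ α * s (v ℕ.+ n) + γ * s n) →
    ∀ j n → s (j ℕ.* u ℕ.+ n) ≈ pair j (binomial α γ j) (λ t → s (t ℕ.* v ℕ.+ n))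
  iterate-relation s u v α γ rel zero n = begin
    s n                        ≈⟨ solve 1 (λ x → x := (:1 :* :1) :* x) refl (s n) ⟩
    1# * 1# * s n              ≈⟨ *-congʳ (1·≈id _ (nC0≡1 0)) ⟨
    binomial α γ 0 0 * s n     ∎
  iterate-relation s u v α γ rel (suc j) n = begin
    s (u ℕ.+ j ℕ.* u ℕ.+ n)
      ≡⟨ ≡.cong s (≡.trans (≡.cong (ℕ._+ n) (ℕₚ.+-comm u (j ℕ.* u))) (ℕₚ.+-assoc (j ℕ.* u) u n)) ⟩
    s (j ℕ.* u ℕ.+ (u ℕ.+ n))
      ≈⟨ iterate-relation s u v α γ rel j (u ℕ.+ n) ⟩
    pair j K (λ t → s (t ℕ.* v ℕ.+ (u ℕ.+ n)))
      ≈⟨ pair-cong j (λ _ → refl) (λ t → begin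
           s (t ℕ.* v ℕ.+ (u ℕ.+ n))
             ≡⟨ ≡.cong s (swap (t ℕ.* v) u n) ⟩
           s (u ℕ.+ (t ℕ.* v ℕ.+ n))
             ≈⟨ rel (t ℕ.* v ℕ.+ n) ⟩
           α * s (v ℕ.+ (t ℕ.* v ℕ.+ n)) + γ * s (t ℕ.* v ℕ.+ n)
             ≡⟨ ≡.cong (λ i → α * s i + γ * s (t ℕ.* v ℕ.+ n)) (≡.sym (ℕₚ.+-assoc v (t ℕ.* v) n)) ⟩
           α * w (suc t) + γ * w t ∎) ⟩
    pair j K (λ t → α * w (suc t) + γ * w t)
      ≈⟨ pair-linearʳ j α γ K (w ∘ suc) w ⟩
    α * pair j K (w ∘ suc) + γ * pair j K w
      ≈⟨ pair-linMul j α γ K w (binomial-top α γ j) ⟨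
    pair (suc j) (linMul α γ K) w
      ≈⟨ pair-cong (suc j) {s = w} (binomial-suc α γ j) (λ _ → refl) ⟨
    pair (suc j) (binomial α γ (suc j)) w ∎
    where
    K = binomial α γ j
    w : Sequence
    w t = s (t ℕ.* v ℕ.+ n)
    swap : ∀ a b d → a ℕ.+ (b ℕ.+ d) ≡ b ℕ.+ (a ℕ.+ d)
    swap a b d = ≡.trans (≡.sym (ℕₚ.+-assoc a b d))
      (≡.trans (≡.cong (ℕ._+ d) (ℕₚ.+-comm a b)) (ℕₚ.+-assoc b a d))

  -- The Frobenius principle T^u = α T^v + γ ⇒ T^(eu) = α^e T^(ev) + γ^e, where T
  -- is the shift operator acting on sequences.
  Frobenius : ℕ → Set (c ⊔ ℓ)
  Frobenius e = ∀ (s : Sequence) u v α γ →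
    (∀ n → s (u ℕ.+ n) ≈ α * s (v ℕ.+ n) + γ * s n) →
    ∀ n → s (e ℕ.* u ℕ.+ n) ≈ pow α e * s (e ℕ.* v ℕ.+ n) + pow γ e * s n

  frobenius-1 : Frobenius 1
  frobenius-1 s u v α γ rel n = begin
    s (1 ℕ.* u ℕ.+ n)                ≡⟨ ≡.cong (λ i → s (i ℕ.+ n)) (ℕₚ.*-identityˡ u) ⟩
    s (u ℕ.+ n)                      ≈⟨ rel n ⟩
    α * s (v ℕ.+ n) + γ * s n
      ≈⟨ +-cong (*-cong (sym (*-identityʳ α)) (reflexive (≡.cong (λ i → s (i ℕ.+ n)) (≡.sym (ℕₚ.*-identityˡ v))))) (*-congʳ (sym (*-identityʳ γ))) ⟩
    pow α 1 * s (1 ℕ.* v ℕ.+ n) + pow γ 1 * s n ∎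

  frobenius-* : ∀ {e f} → Frobenius e → Frobenius f → Frobenius (e ℕ.* f)
  frobenius-* {e} {f} frob-e frob-f s u v α γ rel n = begin
    s (e ℕ.* f ℕ.* u ℕ.+ n)
      ≡⟨ ≡.cong (λ i → s (i ℕ.+ n)) (reassociate u) ⟩
    s (f ℕ.* (e ℕ.* u) ℕ.+ n)
      ≈⟨ frob-f s (e ℕ.* u) (e ℕ.* v) _ _ (frob-e s u v α γ rel) n ⟩
    pow (pow α e) f * s (f ℕ.* (e ℕ.* v) ℕ.+ n) + pow (pow γ e) f * s n
      ≈⟨ +-cong (*-cong (pow-* α e f) (reflexive (≡.cong (λ i → s (i ℕ.+ n)) (≡.sym (reassociate v))))) (*-congʳ (pow-* γ e f)) ⟩
    pow α (e ℕ.* f) * s (e ℕ.* f ℕ.* v ℕ.+ n) + pow γ (e ℕ.* f) * s n ∎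
    where
    reassociate : ∀ i → e ℕ.* f ℕ.* i ≡ f ℕ.* (e ℕ.* i)
    reassociate i = ≡.trans (≡.cong (ℕ._* i) (ℕₚ.*-comm e f)) (ℕₚ.*-assoc f e i)

  frobenius-^ : ∀ {e} → Frobenius e → ∀ m → Frobenius (e ℕ.^ m)
  frobenius-^     frob-e zero    = frobenius-1
  frobenius-^ {e} frob-e (suc m) = frobenius-* {e} frob-e (frobenius-^ frob-e m)

  -- All inner binomial coefficients are multiples of the prime, hence zero in the ring, and the
  -- expansion of `iterate-relation` keeps only its two extreme terms.
  frobenius-prime : ∀ {p} → Prime p → p · 1# ≈ 0# → Frobenius p
  frobenius-prime {suc p} p-prime p≈0 s u v α γ rel n = begin
    s (suc p ℕ.* u ℕ.+ n)
      ≈⟨ iterate-relation s u v α γ rel (suc p) n ⟩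
    K 0 * s n + pair p (K ∘ suc) (λ t → s (suc t ℕ.* v ℕ.+ n))
      ≈⟨ +-congˡ (pair-top p (K ∘ suc) (λ t → s (suc t ℕ.* v ℕ.+ n)) middle) ⟩
    K 0 * s n + K (suc p) * s (suc p ℕ.* v ℕ.+ n)
      ≈⟨ +-cong (*-congʳ bottom) (*-congʳ top) ⟩
    pow γ (suc p) * s n + pow α (suc p) * s (suc p ℕ.* v ℕ.+ n)
      ≈⟨ +-comm _ _ ⟩
    pow α (suc p) * s (suc p ℕ.* v ℕ.+ n) + pow γ (suc p) * s n ∎
    where
    K = binomial α γ (suc p)
    bottom : K 0 ≈ pow γ (suc p)
    bottom = trans (1·≈id _ (nC0≡1 (suc p))) (*-identityˡ _)
    top : K (suc p) ≈ pow α (suc p)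
    top = trans (1·≈id _ (nCn≡1 (suc p)))
      (trans (*-congˡ (reflexive (≡.cong (pow γ) (ℕₚ.n∸n≡0 (suc p))))) (*-identityʳ _))
    middle : ∀ t → t < p → K (suc t) ≈ 0#
    middle t t<p with prime∣binomial t p-prime (s≤s t<p)
    ... | divides m eq = begin
      (suc p C suc t) · x            ≡⟨ ≡.cong (_· x) eq ⟩
      (m ℕ.* suc p) · x              ≈⟨ ×-congʳ (m ℕ.* suc p) (*-identityˡ x) ⟨
      (m ℕ.* suc p) · (1# * x)       ≈⟨ ×-assoc-* (m ℕ.* suc p) 1# x ⟨
      ((m ℕ.* suc p) · 1#) * x       ≈⟨ *-congʳ (×1-homo-* m (suc p)) ⟩
      ((m · 1#) * (suc p · 1#)) * x  ≈⟨ *-congʳ (*-congˡ p≈0) ⟩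
      ((m · 1#) * 0#) * x            ≈⟨ solve 2 (λ a b → a :* :0 :* b := :0) refl _ _ ⟩
      0#                             ∎
      where x = pow α (suc t) * pow γ (suc p ∸ suc t)

  -- Read off from the geometric sequence of ratio `x + y`, on which T acts as x + y; so `u` is 1
  -- and `v` is 0.
  pow-homo-+ : ∀ {e} → Frobenius e → ∀ x y → pow (x + y) e ≈ pow x e + pow y e
  pow-homo-+ {e} frob-e x y = begin
    s e
      ≡⟨ ≡.cong s (≡.sym (≡.trans (ℕₚ.+-identityʳ _) (ℕₚ.*-identityʳ e))) ⟩
    s (e ℕ.* 1 ℕ.+ 0)                              ≈⟨ frob-e s 1 0 x y (λ n → distribʳ _ x y) 0 ⟩
    pow x e * s (e ℕ.* 0 ℕ.+ 0) + pow y e * 1#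
      ≡⟨ ≡.cong (λ i → pow x e * s (i ℕ.+ 0) + pow y e * 1#) (ℕₚ.*-zeroʳ e) ⟩
    pow x e * 1# + pow y e * 1#                    ≈⟨ +-cong (*-identityʳ _) (*-identityʳ _) ⟩
    pow x e + pow y e                              ∎
    where
    s : Sequence
    s = pow (x + y)

-- Cancellation in a field

module FieldProperties {c ℓ} (F : CommutativeRing c ℓ) (isField : IsField F) where
  open CommutativeRing F hiding (zero)
  open IsField isField
  open Poly F using (pow)
  open GroupProperties +-group using (x∙y⁻¹≈ε⇒x≈y)
  open SetoidReasoning setoid

  x*y≈0⇒y≈0 : ∀ {x y} → ¬ (x ≈ 0#) → x * y ≈ 0# → y ≈ 0#
  x*y≈0⇒y≈0 {x} {y} x≉0 xy≈0 with inverse x x≉0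
  ... | x⁻¹ , xx⁻¹≈1 = begin
    y               ≈⟨ *-identityˡ y ⟨
    1# * y          ≈⟨ *-congʳ (trans (*-comm x⁻¹ x) xx⁻¹≈1) ⟨
    x⁻¹ * x * y     ≈⟨ *-assoc x⁻¹ x y ⟩
    x⁻¹ * (x * y)   ≈⟨ *-congˡ xy≈0 ⟩
    x⁻¹ * 0#        ≈⟨ zeroʳ x⁻¹ ⟩
    0#              ∎

  *-nonzero : ∀ {x y} → ¬ (x ≈ 0#) → ¬ (y ≈ 0#) → ¬ (x * y ≈ 0#)
  *-nonzero x≉0 y≉0 = y≉0 ∘ x*y≈0⇒y≈0 x≉0

  pow-nonzero : ∀ {x} n → ¬ (x ≈ 0#) → ¬ (pow x n ≈ 0#)
  pow-nonzero zero    x≉0 = 1≉0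
  pow-nonzero (suc n) x≉0 = *-nonzero x≉0 (pow-nonzero n x≉0)

  x-y≉0 : ∀ {x y} → ¬ (x ≈ y) → ¬ (x - y ≈ 0#)
  x-y≉0 {x} {y} x≉y = x≉y ∘ x∙y⁻¹≈ε⇒x≈y x y

  *-cancelˡ-nonzero : ∀ {x y z} → ¬ (x ≈ 0#) → x * y ≈ x * z → y ≈ z
  *-cancelˡ-nonzero {x} {y} {z} x≉0 xy≈xz =
    x∙y⁻¹≈ε⇒x≈y y z (x*y≈0⇒y≈0 x≉0 (begin
      x * (y - z)     ≈⟨ solve 3 (λ x y z → x :* (y :- z) := x :* y :- x :* z) refl x y z ⟩
      x * y - x * z   ≈⟨ +-congʳ xy≈xz ⟩
      x * z - x * z   ≈⟨ -‿inverseʳ _ ⟩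
      0#              ∎))
    where open Solver F using (solve; _:*_; _:-_; _:=_)

-- Finite fields: the characteristic and x^N = x

module FiniteField {c ℓ} (F : CommutativeRing c ℓ) (isField : IsField F)
                   {N} (hasOrder : HasOrder F N) where
  open CommutativeRing F hiding (zero)
  open IsField isField
  open Poly F using (pow)
  open FieldProperties F isField
  open Sequences F using (pow≡^)
  open Multiples semiring renaming (_×_ to _·_)
  open Inverse hasOrder using (to; from; to-cong)
    renaming (strictlyInverseˡ to to∘from; strictlyInverseʳ to from∘to)
  open SetoidReasoning setoid
  open Solver F using (solve; _:+_; _:-_; _:=_; :0; :1)

  to-injective : ∀ {x y} → to x ≡ to y → x ≈ y
  to-injective {x} {y} eq =
    trans (sym (from∘to x)) (trans (reflexive (≡.cong from eq)) (from∘to y))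

  from-injective : ∀ {i j} → from i ≈ from j → i ≡ j
  from-injective {i} {j} eq =
    ≡.trans (≡.sym (to∘from i)) (≡.trans (to-cong eq) (to∘from j))

  infix 4 _≟_
  _≟_ : Decidable _≈_
  x ≟ y = map′ to-injective to-cong (to x Finₚ.≟ to y)

  elements : List Carrier
  elements = tabulate from

  length-elements : length elements ≡ N
  length-elements = List.length-tabulate from

  elements-unique : Unique setoid elements
  elements-unique = Unique.tabulate⁺ setoid from-injective

  bijection⇒permutation : (φ ψ : Carrier → Carrier) →
    Congruent _≈_ _≈_ φ → Congruent _≈_ _≈_ ψ →
    (∀ x → φ (ψ x) ≈ x) → (∀ x → ψ (φ x) ≈ x) → Permutation′ N
  bijection⇒permutation φ ψ φ-cong ψ-cong φψ ψφ =
    permutation (to ∘ φ ∘ from) (to ∘ ψ ∘ from)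
      (λ i → ≡.trans (to-cong (trans (φ-cong (from∘to _)) (φψ _))) (to∘from i))
      (λ i → ≡.trans (to-cong (trans (ψ-cong (from∘to _)) (ψφ _))) (to∘from i))

  module _ {m ℓ′} (M : CommutativeMonoid m ℓ′) where
    open CommutativeMonoid M using () renaming (Carrier to A; _≈_ to _≈ᴹ_; trans to transᴹ)
    open Sum M using (sum; sum-permute; sum-cong-≋)

    -- Stated for any commutative monoid, as it serves additively for `order·1≈0` and
    -- multiplicatively for `pow-order-nonzero`.
    sum-reindex : (h : Carrier → A) → Congruent _≈_ _≈ᴹ_ h → (φ ψ : Carrier → Carrier) →
      Congruent _≈_ _≈_ φ → Congruent _≈_ _≈_ ψ →
      (∀ x → φ (ψ x) ≈ x) → (∀ x → ψ (φ x) ≈ x) →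
      sum (h ∘ from) ≈ᴹ sum (h ∘ φ ∘ from)
    sum-reindex h h-cong φ ψ φ-cong ψ-cong φψ ψφ =
      transᴹ (sum-permute (h ∘ from) (bijection⇒permutation φ ψ φ-cong ψ-cong φψ ψφ))
        (sum-cong-≋ (λ i → h-cong (from∘to (φ (from i)))))

  module ∑ = Sum +-commutativeMonoid
  module ∏ = Sum *-commutativeMonoid

  -- Translation by `1#` permutes the field, so the sum of all elements stays the same when `1#` is
  -- added to each of them.
  order·1≈0 : N · 1# ≈ 0#
  order·1≈0 = begin
    N · 1#                 ≈⟨ solve 2 (λ x y → x := (y :+ x) :- y) refl (N · 1#) total ⟩
    (total + N · 1#) - total   ≈⟨ +-congʳ total+N·1≈total ⟩
    total - total          ≈⟨ -‿inverseʳ total ⟩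
    0#                     ∎
    where
    total = ∑.sum from
    total+N·1≈total : total + N · 1# ≈ total
    total+N·1≈total = begin
      total + N · 1#                       ≈⟨ +-congˡ (∑.sum-replicate N) ⟨
      total + ∑.sum {N} (λ _ → 1#)         ≈⟨ ∑.∑-distrib-+ from (λ _ → 1#) ⟨
      ∑.sum (λ i → from i + 1#)
        ≈⟨ sum-reindex +-commutativeMonoid (λ x → x) (λ eq → eq) (_+ 1#) (_- 1#) +-congʳ +-congʳ
                                                (solve 1 (λ x → x :- :1 :+ :1 := x) refl) (solve 1 (λ x → x :+ :1 :- :1 := x) refl) ⟨
      total                                ∎

  product-nonzero : ∀ {n} (f : Vector Carrier n) → (∀ i → ¬ (f i ≈ 0#)) → ¬ (∏.sum f ≈ 0#)
  product-nonzero {zero}  f f≉0 = 1≉0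
  product-nonzero {suc n} f f≉0 = *-nonzero (f≉0 Fin.zero) (product-nonzero (f ∘ Fin.suc) (f≉0 ∘ Fin.suc))

  product-single : ∀ {n} (f : Vector Carrier n) i {x} → f i ≈ x →
    (∀ j → j ≢ i → f j ≈ 1#) → ∏.sum f ≈ x
  product-single {suc n} f i {x} fi≈x others = begin
    ∏.sum f                              ≈⟨ ∏.sum-remove {i = i} f ⟩
    f i * ∏.sum (f ∘ punchIn i)
      ≈⟨ *-cong fi≈x (∏.sum-cong-≋ (λ j → others (punchIn i j) (Finₚ.punchInᵢ≢i i j))) ⟩
    x * ∏.sum {n} (λ _ → 1#)             ≈⟨ *-congˡ (∏.sum-replicate-zero n) ⟩
    x * 1#                               ≈⟨ *-identityʳ x ⟩
    x                                    ∎

  -- Overriding the value at zero lets a product over the nonzero elements range over all `N`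
  -- indices.
  if-zero : Carrier → (Carrier → Carrier) → Carrier → Carrier
  if-zero z g x with x ≟ 0#
  ... | yes _ = z
  ... | no  _ = g x

  if-zero-yes : ∀ z g {x} → x ≈ 0# → if-zero z g x ≈ z
  if-zero-yes z g {x} x≈0 with x ≟ 0#
  ... | yes _   = refl
  ... | no  x≉0 = contradiction x≈0 x≉0

  if-zero-no : ∀ z g {x} → ¬ (x ≈ 0#) → if-zero z g x ≈ g x
  if-zero-no z g {x} x≉0 with x ≟ 0#
  ... | yes x≈0 = contradiction x≈0 x≉0
  ... | no  _   = refl

  -- Multiplication by `x` permutes the field and so preserves the product `units` of the nonzero
  -- elements. As the product has all `N` indices, the one of zero contributes a surplus factor `x`,
  -- which `mark` records; hence the exponent `N` in place of `N - 1`.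
  pow-order-nonzero : ∀ x → ¬ (x ≈ 0#) → pow x N ≈ x
  pow-order-nonzero x x≉0 = *-cancelˡ-nonzero units≉0 (begin
    units * pow x N                                    ≈⟨ *-comm _ _ ⟩
    pow x N * units                                    ≡⟨ ≡.cong (_* units) (pow≡^ x N) ⟩
    _                                                  ≈⟨ *-congʳ (∏.sum-replicate N) ⟨
    ∏.sum {N} (λ _ → x) * units                        ≈⟨ ∏.∑-distrib-+ (λ _ → x) (unit ∘ from) ⟨
    ∏.sum (λ i → x * unit (from i))                    ≈⟨ ∏.sum-cong-≋ (λ i → exchange (from i)) ⟩
    ∏.sum (λ i → unit (x * from i) * mark (from i))
      ≈⟨ ∏.∑-distrib-+ (λ i → unit (x * from i)) (mark ∘ from) ⟩
    ∏.sum (λ i → unit (x * from i)) * ∏.sum (mark ∘ from)  ≈⟨ *-cong (sym reindexed) marks≈x ⟩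
    units * x                                          ∎)
    where
    unit mark : Carrier → Carrier
    unit = if-zero 1# (λ y → y)
    mark = if-zero x (λ _ → 1#)
    units = ∏.sum (unit ∘ from)
    x⁻¹ = proj₁ (inverse x x≉0)
    xx⁻¹≈1 : x * x⁻¹ ≈ 1#
    xx⁻¹≈1 = proj₂ (inverse x x≉0)
    unit-cong : Congruent _≈_ _≈_ unit
    unit-cong {y} {z} y≈z with y ≟ 0#
    ... | yes y≈0 = sym (if-zero-yes 1# _ (trans (sym y≈z) y≈0))
    ... | no  y≉0 = trans y≈z (sym (if-zero-no 1# _ (y≉0 ∘ trans y≈z)))
    unit≉0 : ∀ y → ¬ (unit y ≈ 0#)
    unit≉0 y with y ≟ 0#
    ... | yes _   = 1≉0
    ... | no  y≉0 = y≉0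
    units≉0 : ¬ (units ≈ 0#)
    units≉0 = product-nonzero (unit ∘ from) (unit≉0 ∘ from)
    exchange : ∀ y → x * unit y ≈ unit (x * y) * mark y
    exchange y with y ≟ 0#
    ... | yes y≈0 = begin
      x * 1#             ≈⟨ *-comm x 1# ⟩
      1# * x             ≈⟨ *-congʳ (if-zero-yes 1# _ (trans (*-congˡ y≈0) (zeroʳ x))) ⟨
      unit (x * y) * x   ∎
    ... | no  y≉0 = begin
      x * y              ≈⟨ if-zero-no 1# _ (*-nonzero x≉0 y≉0) ⟨
      unit (x * y)       ≈⟨ *-identityʳ _ ⟨
      unit (x * y) * 1#  ∎
    cancel-inverse : ∀ {a b} → a * b ≈ 1# → ∀ y → a * (b * y) ≈ y
    cancel-inverse {a} {b} ab≈1 y = trans (sym (*-assoc a b y)) (trans (*-congʳ ab≈1) (*-identityˡ y))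
    reindexed : units ≈ ∏.sum (λ i → unit (x * from i))
    reindexed = sum-reindex *-commutativeMonoid unit unit-cong (x *_) (x⁻¹ *_) *-congˡ *-congˡ
      (cancel-inverse xx⁻¹≈1) (cancel-inverse (trans (*-comm x⁻¹ x) xx⁻¹≈1))
    marks≈x : ∏.sum (mark ∘ from) ≈ x
    marks≈x = product-single (mark ∘ from) (to 0#)
      (if-zero-yes x _ (from∘to 0#))
      (λ j j≢0 → if-zero-no x _ (λ eq → j≢0 (from-injective (trans eq (sym (from∘to 0#))))))

  pow-order : 1 ≤ N → ∀ x → pow x N ≈ x
  pow-order (s≤s {n = n} _) x with x ≟ 0#
  ... | no  x≉0 = pow-order-nonzero x x≉0
  ... | yes x≈0 = trans (*-congʳ x≈0) (trans (zeroˡ _) (sym x≈0))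

  ^·1 : ∀ n j → (n ℕ.^ j) · 1# ≈ pow (n · 1#) j
  ^·1 n zero    = ×-homo-1 1#
  ^·1 n (suc j) = trans (×1-homo-* n (n ℕ.^ j)) (*-congˡ (^·1 n j))

  -- A field has no nonzero nilpotents. This takes the vanishing of q^k in the field down to q, and
  -- that of q = p^m down to p.
  n^j·1≈0⇒n·1≈0 : ∀ n j → (n ℕ.^ j) · 1# ≈ 0# → n · 1# ≈ 0#
  n^j·1≈0⇒n·1≈0 n j eq with n · 1# ≟ 0#
  ... | yes n≈0 = n≈0
  ... | no  n≉0 = contradiction (trans (sym (^·1 n j)) eq) (pow-nonzero j n≉0)

-- Products of operators T - r, division by X - r, and trinomials

module LinearProducts {c ℓ} (R : CommutativeRing c ℓ) where
  open CommutativeRing R hiding (zero)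
  open Poly R
  open Sequences R
  open Multiples semiring renaming (_×_ to _·_)
  open Solver R using (solve; _:+_; _:*_; _:-_; _:=_; :-_; :0; :1)
  open SetoidReasoning setoid

  -- The operator T - r for the shift T.
  Δ : Carrier → Sequence → Sequence
  Δ r s n = s (suc n) - r * s n

  Δ* : List Carrier → Sequence → Sequence
  Δ* []       s = s
  Δ* (r ∷ rs) s = Δ* rs (Δ r s)

  Δ-cong : ∀ r {s t} → (∀ n → s n ≈ t n) → ∀ n → Δ r s n ≈ Δ r t n
  Δ-cong r s≈t n = +-cong (s≈t (suc n)) (-‿cong (*-congˡ (s≈t n)))

  Δ*-cong : ∀ rs {s t} → (∀ n → s n ≈ t n) → ∀ n → Δ* rs s n ≈ Δ* rs t n
  Δ*-cong []       s≈t = s≈t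
  Δ*-cong (r ∷ rs) s≈t = Δ*-cong rs (Δ-cong r s≈t)

  Δ*-zero : ∀ rs {s} → (∀ n → s n ≈ 0#) → ∀ n → Δ* rs s n ≈ 0#
  Δ*-zero []       s≈0 = s≈0
  Δ*-zero (r ∷ rs) s≈0 = Δ*-zero rs λ n →
    trans (Δ-cong r s≈0 n) (solve 1 (λ r → :0 :- r :* :0 := :0) refl r)

  Δ*-shift : ∀ rs s n → Δ* rs (s ∘ suc) n ≡ Δ* rs s (suc n)
  Δ*-shift []       s n = ≡.refl
  Δ*-shift (r ∷ rs) s n = Δ*-shift rs (Δ r s) n

  Δ-comm : ∀ a b s n → Δ a (Δ b s) n ≈ Δ b (Δ a s) n
  Δ-comm a b s n =
    solve 5 (λ a b x y z → (x :- b :* y) :- a :* (y :- b :* z) := (x :- a :* y) :- b :* (y :- a :* z))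
      refl a b (s (suc (suc n))) (s (suc n)) (s n)

  Δ*-comm : ∀ rs a s n → Δ* rs (Δ a s) n ≈ Δ a (Δ* rs s) n
  Δ*-comm []       a s n = refl
  Δ*-comm (r ∷ rs) a s n = trans (Δ*-cong rs (Δ-comm r a s) n) (Δ*-comm rs a (Δ r s) n)

  linProd-linMul : ∀ r rs n → linProd (r ∷ rs) n ≈ linMul 1# (- r) (linProd rs) n
  linProd-linMul r rs zero    = solve 2 (λ r x → :- (r :* x) := :- r :* x) refl r _
  linProd-linMul r rs (suc n) =
    solve 3 (λ r x y → x :- r :* y := :1 :* x :+ :- r :* y) refl r _ _

  linProd-above : ∀ rs {n} → length rs < n → linProd rs n ≈ 0#
  linProd-above []       {suc n} _         = refl
  linProd-above (r ∷ rs) {suc n} (s≤s d<n) = begin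
    linProd rs n - r * linProd rs (suc n)
      ≈⟨ +-cong (linProd-above rs d<n) (-‿cong (*-congˡ (linProd-above rs (ℕₚ.m<n⇒m<1+n d<n)))) ⟩
    0# - r * 0#
      ≈⟨ solve 1 (λ r → :0 :- r :* :0 := :0) refl r ⟩
    0# ∎

  pair-linear-factor : ∀ d r g s → g (suc d) ≈ 0# →
    pair (suc d) (linMul 1# (- r) g) s ≈ pair d g (Δ r s)
  pair-linear-factor d r g s g≈0 = begin
    pair (suc d) (linMul 1# (- r) g) s                ≈⟨ pair-linMul d 1# (- r) g s g≈0 ⟩
    1# * pair d g (s ∘ suc) + - r * pair d g s        ≈⟨ pair-linearʳ d 1# (- r) g (s ∘ suc) s ⟨
    pair d g (λ n → 1# * s (suc n) + - r * s n)
      ≈⟨ pair-cong d (λ _ → refl) (λ n → solve 3 (λ r x y → :1 :* x :+ :- r :* y := x :- r :* y) refl r (s (suc n)) (s n)) ⟩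
    pair d g (Δ r s)                                  ∎

  -- Through this an identity between coefficients becomes one between operators on sequences.
  pair-linProd : ∀ rs s → pair (length rs) (linProd rs) s ≈ Δ* rs s 0
  pair-linProd []       s = *-identityˡ _
  pair-linProd (r ∷ rs) s = begin
    pair (suc (length rs)) (linProd (r ∷ rs)) s
      ≈⟨ pair-cong (suc (length rs)) {s = s} (linProd-linMul r rs) (λ _ → refl) ⟩
    pair (suc (length rs)) (linMul 1# (- r) (linProd rs)) s
      ≈⟨ pair-linear-factor (length rs) r (linProd rs) s (linProd-above rs (ℕₚ.n<1+n (length rs))) ⟩
    pair (length rs) (linProd rs) (Δ r s)
      ≈⟨ pair-linProd rs (Δ r s) ⟩
    Δ* rs (Δ r s) 0 ∎

  -- Pairing with the geometric sequence of ratio `r` is evaluation at `r`.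
  Root : ℕ → Sequence → Carrier → Set ℓ
  Root d f r = pair d f (pow r) ≈ 0#

  pair-scaleʳ : ∀ d α f s → pair d f (λ n → α * s n) ≈ α * pair d f s
  pair-scaleʳ zero    α f s = solve 3 (λ α x y → x :* (α :* y) := α :* (x :* y)) refl α (f 0) (s 0)
  pair-scaleʳ (suc d) α f s = trans (+-congˡ (pair-scaleʳ d α (f ∘ suc) (s ∘ suc)))
    (solve 4 (λ α x y z → x :* (α :* y) :+ α :* z := α :* (x :* y :+ z)) refl α (f 0) (s 0) _)

  pair-zeroˡ : ∀ d f s → (∀ n → f n ≈ 0#) → pair d f s ≈ 0#
  pair-zeroˡ d f s f≈0 = begin
    pair d f s   ≈⟨ pair-top d f s (λ n _ → f≈0 n) ⟩
    f d * s d    ≈⟨ *-congʳ (f≈0 d) ⟩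
    0# * s d     ≈⟨ zeroˡ (s d) ⟩
    0#           ∎

  module _ (d : ℕ) (f : Sequence) (bounded : ∀ n → suc d < n → f n ≈ 0#) (r : Carrier) where

    -- Synthetic division by X - r: coefficient `n` is the value at `r` of what remains of `f` after
    -- its terms of degree at most `n` are dropped and X^(n+1) is divided out.
    quotient : Sequence
    quotient n = pair d (λ j → f (j ℕ.+ suc n)) (pow r)

    quotient-step : ∀ n → quotient n ≈ f (suc n) + r * quotient (suc n)
    quotient-step n = begin
      quotient n
        -- A vanishing term of index `suc d` is appended, so that splitting off the lowest term
        -- leaves a sum as long as the one in `quotient (suc n)`.
        ≈⟨ solve 2 (λ x y → x := x :+ :0 :* y) refl (quotient n) (pow r (suc d)) ⟩
      quotient n + 0# * pow r (suc d)
        ≈⟨ +-congˡ (*-congʳ (bounded _ (ℕₚ.m<m+n (suc d) (s≤s z≤n)))) ⟨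
      quotient n + f (suc d ℕ.+ suc n) * pow r (suc d)
        ≈⟨ pair-last d (λ j → f (j ℕ.+ suc n)) (pow r) ⟨
      f (suc n) * 1# + pair d (λ j → f (suc j ℕ.+ suc n)) (λ j → r * pow r j)
        ≈⟨ +-cong (*-identityʳ _) (pair-scaleʳ d r _ (pow r)) ⟩
      f (suc n) + r * pair d (λ j → f (suc j ℕ.+ suc n)) (pow r)
        ≈⟨ +-congˡ (*-congˡ (pair-cong d (λ j → reflexive (≡.cong f (≡.sym (ℕₚ.+-suc j (suc n))))) (λ _ → refl))) ⟩
      f (suc n) + r * quotient (suc n) ∎

    quotient-above : ∀ n → d < n → quotient n ≈ 0#
    quotient-above n d<n = pair-zeroˡ d _ (pow r)
      (λ j → bounded _ (ℕₚ.<-≤-trans (s≤s d<n) (ℕₚ.m≤n+m (suc n) j)))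

    quotient-top : quotient d ≈ f (suc d)
    quotient-top = begin
      quotient d                          ≈⟨ quotient-step d ⟩
      f (suc d) + r * quotient (suc d)
        ≈⟨ +-congˡ (*-congˡ (quotient-above (suc d) (ℕₚ.n<1+n d))) ⟩
      f (suc d) + r * 0#
        ≈⟨ solve 2 (λ x r → x :+ r :* :0 := x) refl (f (suc d)) r ⟩
      f (suc d)                           ∎

    -- Higher coefficients are Horner's step. The root enters at the constant coefficient only,
    -- where the remainder f(r) of the division sits.
    quotient-correct : Root (suc d) f r → ∀ n → f n ≈ linMul 1# (- r) quotient n
    quotient-correct root zero = begin
      f 0
        ≈⟨ solve 3 (λ x r y → x := x :* :1 :+ r :* y :- r :* y) refl (f 0) r (quotient 0) ⟩
      f 0 * 1# + r * quotient 0 - r * quotient 0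
        ≈⟨ +-congʳ (+-congˡ (begin
             r * quotient 0
               ≈⟨ pair-scaleʳ d r _ (pow r) ⟨
             pair d (λ j → f (j ℕ.+ 1)) (λ j → r * pow r j)
               ≈⟨ pair-cong d (λ j → reflexive (≡.cong f (ℕₚ.+-comm j 1))) (λ _ → refl) ⟩
             pair d (f ∘ suc) (λ j → r * pow r j) ∎)) ⟩
      pair (suc d) f (pow r) - r * quotient 0
        ≈⟨ +-congʳ root ⟩
      0# - r * quotient 0
        ≈⟨ solve 2 (λ r y → :0 :- r :* y := :- r :* y) refl r (quotient 0) ⟩
      - r * quotient 0 ∎
    quotient-correct root (suc n) = begin
      f (suc n)
        ≈⟨ solve 3 (λ x r y → x := (x :+ r :* y) :+ :- r :* y) refl (f (suc n)) r (quotient (suc n)) ⟩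
      (f (suc n) + r * quotient (suc n)) + - r * quotient (suc n)
        ≈⟨ +-congʳ (trans (*-identityˡ _) (quotient-step n)) ⟨
      1# * quotient n + - r * quotient (suc n) ∎

    quotient-eval : Root (suc d) f r → ∀ x →
      pair (suc d) f (pow x) ≈ (x - r) * pair d quotient (pow x)
    quotient-eval root x = begin
      pair (suc d) f (pow x)
        ≈⟨ pair-cong (suc d) {s = pow x} (quotient-correct root) (λ _ → refl) ⟩
      pair (suc d) (linMul 1# (- r) quotient) (pow x)
        ≈⟨ pair-linear-factor d r quotient (pow x) (quotient-above (suc d) (ℕₚ.n<1+n d)) ⟩
      pair d quotient (Δ r (pow x))
        ≈⟨ pair-cong d (λ _ → refl) (λ n → solve 3 (λ x r y → x :* y :- r :* y := (x :- r) :* y) refl x r (pow x n)) ⟩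
      pair d quotient (λ n → (x - r) * pow x n)
        ≈⟨ pair-scaleʳ d (x - r) quotient (pow x) ⟩
      (x - r) * pair d quotient (pow x) ∎

  -- Coefficients of X^(e+2) + αX + β
  trinomial : ℕ → Carrier → Carrier → Sequence
  trinomial e α β zero          = β
  trinomial e α β (suc zero)    = α
  trinomial e α β (suc (suc n)) = if n ≡ᵇ e then 1# else 0#

  trinomial-top : ∀ e α β → trinomial e α β (suc (suc e)) ≈ 1#
  trinomial-top e α β with e ≡ᵇ e | ℕₚ.≡⇒≡ᵇ e e ≡.refl
  ... | true | _ = refl

  trinomial-other : ∀ e α β {n} → n ≢ e → trinomial e α β (suc (suc n)) ≈ 0#
  trinomial-other e α β {n} n≢e with n ≡ᵇ e | ℕₚ.≡ᵇ⇒≡ n e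
  ... | true  | eq = contradiction (eq _) n≢e
  ... | false | _  = refl

  trinomial-above : ∀ e α β n → suc (suc e) < n → trinomial e α β n ≈ 0#
  trinomial-above e α β (suc (suc n)) (s≤s (s≤s e<n)) = trinomial-other e α β (ℕₚ.>⇒≢ e<n)

  pair-trinomial : ∀ e α β s →
    pair (suc (suc e)) (trinomial e α β) s ≈ s (suc (suc e)) + α * s 1 + β * s 0
  pair-trinomial e α β s = begin
    β * s 0 + (α * s 1 + pair e (λ n → trinomial e α β (suc (suc n))) (s ∘ suc ∘ suc))
      ≈⟨ +-congˡ (+-congˡ (trans (pair-top e _ (s ∘ suc ∘ suc) (λ n n<e → trinomial-other e α β (ℕₚ.<⇒≢ n<e)))
           (*-congʳ (trinomial-top e α β)))) ⟩
    β * s 0 + (α * s 1 + 1# * s (suc (suc e)))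
      ≈⟨ solve 3 (λ x y z → x :+ (y :+ :1 :* z) := z :+ y :+ x) refl (β * s 0) (α * s 1) _ ⟩
    s (suc (suc e)) + α * s 1 + β * s 0 ∎

  -- Both boolean tests reduce to the same one. The common shape also covers X^N - X.
  FB≈trinomial : ∀ e B n → FB (suc e) B n ≈ trinomial e (- B) B n
  FB≈trinomial e B zero          = refl
  FB≈trinomial e B (suc zero)    = refl
  FB≈trinomial e B (suc (suc n)) = refl

  -- `Δ a` multiplies a geometric sequence of ratio `r` by `r - a`; the scalar `y` collects these
  -- factors until one of them vanishes.
  Δ*-geometric : ∀ rs {r y} s → Any (r ≈_) rs → (∀ n → s n ≈ y * pow r n) → ∀ n → Δ* rs s n ≈ 0#
  Δ*-geometric (a ∷ rs) {r} {y} s (here r≈a) s≈ = Δ*-zero rs λ n → begin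
    Δ a s n
      ≈⟨ +-cong (s≈ (suc n)) (-‿cong (*-cong (sym r≈a) (s≈ n))) ⟩
    y * (r * pow r n) - r * (y * pow r n)
      ≈⟨ solve 3 (λ y r z → y :* (r :* z) :- r :* (y :* z) := :0) refl y r (pow r n) ⟩
    0#                                     ∎
  Δ*-geometric (a ∷ rs) {r} {y} s (there r∈rs) s≈ = Δ*-geometric rs {r} {(r - a) * y} (Δ a s) r∈rs λ n → begin
    Δ a s n                                ≈⟨ Δ-cong a s≈ n ⟩
    y * (r * pow r n) - a * (y * pow r n)
      ≈⟨ solve 4 (λ y r z a → y :* (r :* z) :- a :* (y :* z) := (r :- a) :* y :* z) refl y r (pow r n) a ⟩
    (r - a) * y * pow r n                  ∎

  data Twice (r : Carrier) : List Carrier → Set (c ⊔ ℓ) where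
    here  : ∀ {a rs} → r ≈ a → Any (r ≈_) rs → Twice r (a ∷ rs)
    there : ∀ {a rs} → Twice r rs → Twice r (a ∷ rs)

  -- A multiple root r also annihilates n ↦ n r^n; this plays the role of the
  -- derivative in excluding multiple roots.
  Δ*-twice : ∀ rs {r x y} s → Twice r rs →
    (∀ n → s n ≈ (n · 1# * x + y) * pow r n) → ∀ n → Δ* rs s n ≈ 0#
  -- The first occurrence of `r` lowers the linear factor n x + y to the constant r x, leaving a
  -- geometric sequence for the second occurrence to kill.
  Δ*-twice (a ∷ rs) {r} {x} {y} s (here r≈a r∈rs) s≈ = Δ*-geometric rs {r} {r * x} (Δ a s) r∈rs λ n → begin
    Δ a s n
      ≈⟨ +-cong (s≈ (suc n)) (-‿cong (*-cong (sym r≈a) (s≈ n))) ⟩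
    ((1# + n · 1#) * x + y) * (r * pow r n) - r * ((n · 1# * x + y) * pow r n)
      ≈⟨ solve 5 (λ m x y r z → ((:1 :+ m) :* x :+ y) :* (r :* z) :- r :* ((m :* x :+ y) :* z) := r :* x :* z)
           refl (n · 1#) x y r (pow r n) ⟩
    r * x * pow r n ∎
  Δ*-twice (a ∷ rs) {r} {x} {y} s (there twice) s≈ =
    Δ*-twice rs {r} {(r - a) * x} {r * x + (r - a) * y} (Δ a s) twice λ n → begin
    Δ a s n
      ≈⟨ Δ-cong a s≈ n ⟩
    ((1# + n · 1#) * x + y) * (r * pow r n) - a * ((n · 1# * x + y) * pow r n)
      ≈⟨ solve 6 (λ m x y r z a → ((:1 :+ m) :* x :+ y) :* (r :* z) :- a :* ((m :* x :+ y) :* z)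
             := (m :* ((r :- a) :* x) :+ (r :* x :+ (r :- a) :* y)) :* z)
           refl (n · 1#) x y r (pow r n) a ⟩
    (n · 1# * ((r - a) * x) + (r * x + (r - a) * y)) * pow r n ∎

  -- Each factor T - r shortens the run of zeros before the `1#` by one, whatever `r` is. So a
  -- product of at most `m` factors cannot annihilate `s`.
  Δ*-impulse : ∀ rs m s → length rs ≤ m → (∀ i → i < m → s i ≈ 0#) → s m ≈ 1# →
    Δ* rs s (m ∸ length rs) ≈ 1#
  Δ*-impulse []       m       s _         low top = top
  Δ*-impulse (r ∷ rs) (suc m) s (s≤s d≤m) low top = Δ*-impulse rs m (Δ r s) d≤m
    (λ i i<m → trans (+-cong (low (suc i) (s≤s i<m)) (-‿cong (*-congˡ (low i (ℕₚ.m<n⇒m<1+n i<m)))))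
                 (solve 1 (λ r → :0 :- r :* :0 := :0) refl r))
    (trans (+-cong top (-‿cong (*-congˡ (low m (ℕₚ.n<1+n m)))))
      (solve 1 (λ r → :1 :- r :* :0 := :1) refl r))

-- Factoring a monic polynomial with enough distinct roots

module Factorisation {c ℓ} (F : CommutativeRing c ℓ) (isField : IsField F) where
  open CommutativeRing F hiding (zero)
  open Poly F
  open Sequences F
  open LinearProducts F
  open FieldProperties F isField
  open SetoidReasoning setoid

  -- Division by X - r keeps the polynomial monic and lowers its degree bound by one; the other
  -- roots pass to the quotient because `x - r` is nonzero and cancels.
  monic⇒linProd : ∀ rs f → (∀ n → length rs < n → f n ≈ 0#) → f (length rs) ≈ 1# →
    Unique setoid rs → All (Root (length rs) f) rs → ∀ n → linProd rs n ≈ f n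
  monic⇒linProd []       f bounded monic _ _ zero    = sym monic
  monic⇒linProd []       f bounded monic _ _ (suc n) = sym (bounded (suc n) (s≤s z≤n))
  monic⇒linProd (r ∷ rs) f bounded monic (r∉rs ∷ unique) (root ∷ roots) n = begin
    linProd (r ∷ rs) n               ≈⟨ linProd-linMul r rs n ⟩
    linMul 1# (- r) (linProd rs) n   ≈⟨ linMul-cong n ⟩
    linMul 1# (- r) g n              ≈⟨ quotient-correct d f bounded r root n ⟨
    f n                              ∎
    where
    d = length rs
    g = quotient d f bounded r
    rest : ∀ n → linProd rs n ≈ g n
    rest = monic⇒linProd rs g (quotient-above d f bounded r)
      (trans (quotient-top d f bounded r) monic) unique
      (All.zipWith (λ (r≉x , x-root) → x*y≈0⇒y≈0 (x-y≉0 (r≉x ∘ sym))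
          (trans (sym (quotient-eval d f bounded r root _)) x-root))
        (r∉rs , roots))
    linMul-cong : ∀ n → linMul 1# (- r) (linProd rs) n ≈ linMul 1# (- r) g n
    linMul-cong zero    = *-congˡ (rest 0)
    linMul-cong (suc n) = +-cong (*-congˡ (rest n)) (*-congˡ (rest (suc n)))

-- Continuants and the iterated Frobenius relation

module Chains {c ℓ} (R : CommutativeRing c ℓ) (q : ℕ) (frob : Sequences.Frobenius R q)
              (B : CommutativeRing.Carrier R) where
  open CommutativeRing R hiding (zero)
  open Poly R
  open Sequences R
  open Solver R using (solve; _:+_; _:*_; _:-_; _:=_; :-_; :0; :1)
  open RingProperties ring using (+-cancelˡ)
  open SetoidReasoning setoid

  σ : Carrier → Carrier
  σ x = pow x q

  β : ℕ → Carrier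
  β i = pow B (q ℕ.^ i)

  frob^ : ∀ i → Frobenius (q ℕ.^ i)
  frob^ = frobenius-^ frob

  pow-homo-0# : ∀ {e} → Frobenius e → pow 0# e ≈ 0#
  pow-homo-0# {e} frob-e = +-cancelˡ (pow 0# e) _ _ (begin
    pow 0# e + pow 0# e   ≈⟨ pow-homo-+ {e} frob-e 0# 0# ⟨
    pow (0# + 0#) e       ≈⟨ pow-cong e (+-identityʳ 0#) ⟩
    pow 0# e              ≈⟨ +-identityʳ _ ⟨
    pow 0# e + 0#         ∎)

  pow-homo-neg : ∀ {e} → Frobenius e → ∀ x → pow (- x) e ≈ - pow x e
  pow-homo-neg {e} frob-e x = +-cancelˡ (pow x e) _ _ (begin
    pow x e + pow (- x) e   ≈⟨ pow-homo-+ {e} frob-e x (- x) ⟨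
    pow (x - x) e           ≈⟨ pow-cong e (-‿inverseʳ x) ⟩
    pow 0# e                ≈⟨ pow-homo-0# {e} frob-e ⟩
    0#                      ≈⟨ -‿inverseʳ _ ⟨
    pow x e - pow x e       ∎)

  σ-cong : ∀ {x y} → x ≈ y → σ x ≈ σ y
  σ-cong = pow-cong q

  σ-0# : σ 0# ≈ 0#
  σ-0# = pow-homo-0# {q} frob

  σ-neg : ∀ x → σ (- x) ≈ - σ x
  σ-neg = pow-homo-neg {q} frob

  σ-sub : ∀ x y → σ (x - y) ≈ σ x - σ y
  σ-sub x y = trans (pow-homo-+ {q} frob x (- y)) (+-congˡ (σ-neg y))

  σ-* : ∀ x y → σ (x * y) ≈ σ x * σ y
  σ-* x y = pow-distrib-* x y q

  β-0 : β 0 ≈ B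
  β-0 = *-identityʳ B

  σ-β : ∀ i → σ (β i) ≈ β (suc i)
  σ-β i = trans (pow-* B (q ℕ.^ i) q) (reflexive (≡.cong (pow B) (ℕₚ.*-comm (q ℕ.^ i) q)))

  β-1 : β 1 ≈ σ B
  β-1 = reflexive (≡.cong (pow B) (ℕₚ.*-identityʳ q))

  -- A root x of F_B satisfies x^q = (Bx - B)/x. Iterating this Möbius
  -- transformation, x^(q^i) = (γ (i+1) x + δ (i+1)) / (γ i x + δ i), where γ and δ
  -- are the solutions of the recurrence below with initial values 0, 1 and 1, 0.
  chain : Carrier → Carrier → ℕ → Carrier
  chain x y zero          = x
  chain x y (suc zero)    = y
  chain x y (suc (suc i)) = β i * (chain x y (suc i) - chain x y i)

  γ δ : ℕ → Carrier
  γ = chain 0# 1#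
  δ = chain 1# 0#

  -- The relation T^(q+1) = BT - B, in the form that `Frobenius` takes, with `u` equal to `suc q`
  -- and `v` to 1.
  Solution : Sequence → Set ℓ
  Solution s = ∀ n → s (suc q ℕ.+ n) ≈ B * s (1 ℕ.+ n) + - B * s n

  module _ (s : Sequence) (solution : Solution s) where

    -- The recurrence raised to the power q^i by the Frobenius principle.
    solution-power : ∀ i n →
      s (q ℕ.^ i ℕ.+ (q ℕ.^ suc i ℕ.+ n)) ≈ β i * (s (q ℕ.^ i ℕ.+ n) - s n)
    solution-power i n = begin
      s (Q ℕ.+ (q ℕ.^ suc i ℕ.+ n))
        ≡⟨ ≡.cong s (≡.sym (ℕₚ.+-assoc Q (q ℕ.* Q) n)) ⟩
      s (suc q ℕ.* Q ℕ.+ n)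
        ≡⟨ ≡.cong (λ m → s (m ℕ.+ n)) (ℕₚ.*-comm (suc q) Q) ⟩
      s (Q ℕ.* suc q ℕ.+ n)
        ≈⟨ frob^ i s (suc q) 1 B (- B) solution n ⟩
      β i * s (Q ℕ.* 1 ℕ.+ n) + pow (- B) Q * s n
        ≈⟨ +-cong (*-congˡ (reflexive (≡.cong (λ m → s (m ℕ.+ n)) (ℕₚ.*-identityʳ Q))))
                  (*-congʳ (pow-homo-neg {Q} (frob^ i) B)) ⟩
      β i * s (Q ℕ.+ n) + - β i * s n
        ≈⟨ solve 3 (λ b x y → b :* x :+ :- b :* y := b :* (x :- y)) refl (β i) _ (s n) ⟩
      β i * (s (Q ℕ.+ n) - s n) ∎
      where Q = q ℕ.^ i

    -- For `pow r` this is the Möbius formula for r^(q^i), cleared of its denominator and multiplied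
    -- by r^n. The linear form makes sense for every solution, the impulse response included.
    solution-chain : ∀ i n →
      γ i * s (q ℕ.^ i ℕ.+ suc n) + δ i * s (q ℕ.^ i ℕ.+ n)
        ≈ γ (suc i) * s (suc n) + δ (suc i) * s n
    solution-chain zero n =
      solve 3 (λ x y z → :0 :* x :+ :1 :* y := :1 :* y :+ :0 :* z) refl _ _ _
    solution-chain (suc i) n = begin
      γ (suc i) * s (Q′ ℕ.+ suc n) + δ (suc i) * s (Q′ ℕ.+ n)
        ≡⟨ ≡.cong (λ m → γ (suc i) * s m + δ (suc i) * s (Q′ ℕ.+ n)) (ℕₚ.+-suc Q′ n) ⟩
      γ (suc i) * s (suc (Q′ ℕ.+ n)) + δ (suc i) * s (Q′ ℕ.+ n)
        -- The induction hypothesis serves twice: here backwards at `Q′ + n`, to reach terms that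
        -- `solution-power` rewrites, and later at `n`, to remove the terms shifted by `Q`.
        ≈⟨ solution-chain i (Q′ ℕ.+ n) ⟨
      γ i * s (Q ℕ.+ suc (Q′ ℕ.+ n)) + δ i * s (Q ℕ.+ (Q′ ℕ.+ n))
        ≡⟨ ≡.cong (λ m → γ i * s (Q ℕ.+ m) + δ i * s (Q ℕ.+ (Q′ ℕ.+ n))) (≡.sym (ℕₚ.+-suc Q′ n)) ⟩
      γ i * s (Q ℕ.+ (Q′ ℕ.+ suc n)) + δ i * s (Q ℕ.+ (Q′ ℕ.+ n))
        ≈⟨ +-cong (*-congˡ (solution-power i (suc n))) (*-congˡ (solution-power i n)) ⟩
      γ i * (β i * (s (Q ℕ.+ suc n) - s (suc n))) + δ i * (β i * (s (Q ℕ.+ n) - s n))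
        ≈⟨ solve 7 (λ g d b x y z w → g :* (b :* (x :- z)) :+ d :* (b :* (y :- w))
               := b :* ((g :* x :+ d :* y) :- (g :* z :+ d :* w)))
             refl (γ i) (δ i) (β i) (s (Q ℕ.+ suc n)) (s (Q ℕ.+ n)) (s (suc n)) (s n) ⟩
      β i * ((γ i * s (Q ℕ.+ suc n) + δ i * s (Q ℕ.+ n)) - (γ i * s (suc n) + δ i * s n))
        ≈⟨ *-congˡ (+-congʳ (solution-chain i n)) ⟩
      β i * ((γ (suc i) * s (suc n) + δ (suc i) * s n) - (γ i * s (suc n) + δ i * s n))
        ≈⟨ solve 7 (λ g d b g′ d′ z w → b :* ((g′ :* z :+ d′ :* w) :- (g :* z :+ d :* w))
               := b :* (g′ :- g) :* z :+ b :* (d′ :- d) :* w)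
             refl (γ i) (δ i) (β i) (γ (suc i)) (δ (suc i)) (s (suc n)) (s n) ⟩
      γ (suc (suc i)) * s (suc n) + δ (suc (suc i)) * s n ∎
      where
      Q  = q ℕ.^ i
      Q′ = q ℕ.^ suc i

  σ-chain : ∀ i → σ (γ (suc (suc i))) ≈ β (suc i) * (σ (γ (suc i)) - σ (γ i))
  σ-chain i = trans (σ-* _ _) (*-cong (σ-β i) (σ-sub _ _))

  -- Both sides obey the same recurrence, because `σ` raises the index of `β` by one, and they agree
  -- at the first two indices.
  δ≈σγ : ∀ i → δ (suc i) ≈ - (B * σ (γ i))
  δ≈σγ zero = begin
    0#              ≈⟨ solve 1 (λ x → :0 := :- (x :* :0)) refl B ⟩
    - (B * 0#)      ≈⟨ -‿cong (*-congˡ σ-0#) ⟨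
    - (B * σ 0#)    ∎
  δ≈σγ (suc zero) = begin
    β 0 * (0# - 1#)  ≈⟨ *-congʳ β-0 ⟩
    B * (0# - 1#)    ≈⟨ solve 1 (λ x → x :* (:0 :- :1) := :- (x :* :1)) refl B ⟩
    - (B * 1#)       ≈⟨ -‿cong (*-congˡ (pow-1# q)) ⟨
    - (B * σ 1#)     ∎
  δ≈σγ (suc (suc i)) = begin
    β (suc i) * (δ (suc (suc i)) - δ (suc i))
      ≈⟨ *-congˡ (+-cong (δ≈σγ (suc i)) (-‿cong (δ≈σγ i))) ⟩
    β (suc i) * (- (B * σ (γ (suc i))) - - (B * σ (γ i)))
      ≈⟨ solve 4 (λ b B x y → b :* (:- (B :* x) :- :- (B :* y)) := :- (B :* (b :* (x :- y)))) refl (β (suc i)) B _ _ ⟩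
    - (B * (β (suc i) * (σ (γ (suc i)) - σ (γ i))))
      ≈⟨ -‿cong (*-congˡ (σ-chain i)) ⟨
    - (B * σ (γ (suc (suc i)))) ∎

  -- The recurrence for γ, read from the other end of the continuant.
  γ-left-recurrence : ∀ i → γ (suc (suc i)) ≈ B * σ (γ (suc i)) - σ B * σ (σ (γ i))
  γ-left-recurrence zero = begin
    β 0 * (1# - 0#)                  ≈⟨ *-congʳ β-0 ⟩
    B * (1# - 0#)
      ≈⟨ solve 2 (λ x y → x :* (:1 :- :0) := x :* :1 :- y :* :0) refl B (σ B) ⟩
    B * 1# - σ B * 0#
      ≈⟨ +-cong (*-congˡ (pow-1# q)) (-‿cong (*-congˡ (trans (σ-cong σ-0#) σ-0#))) ⟨
    B * σ 1# - σ B * σ (σ 0#)        ∎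
  γ-left-recurrence (suc zero) = begin
    β 1 * (β 0 * (1# - 0#) - 1#)     ≈⟨ *-cong β-1 (+-congʳ (*-congʳ β-0)) ⟩
    σ B * (B * (1# - 0#) - 1#)
      ≈⟨ solve 2 (λ x y → y :* (x :* (:1 :- :0) :- :1) := x :* (y :* (:1 :- :0)) :- y :* :1) refl B (σ B) ⟩
    B * (σ B * (1# - 0#)) - σ B * 1#  ≈⟨ +-cong (*-congˡ (begin
        σ (γ 2)                  ≈⟨ σ-chain 0 ⟩
        β 1 * (σ 1# - σ 0#)      ≈⟨ *-cong β-1 (+-cong (pow-1# q) (-‿cong σ-0#)) ⟩
        σ B * (1# - 0#)          ∎))
      (-‿cong (*-congˡ (trans (σ-cong (pow-1# q)) (pow-1# q)))) ⟨
    B * σ (γ 2) - σ B * σ (σ 1#)     ∎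
  γ-left-recurrence (suc (suc i)) = begin
    b * (γ (suc (suc (suc i))) - γ (suc (suc i)))
      ≈⟨ *-congˡ (+-cong (γ-left-recurrence (suc i)) (-‿cong (γ-left-recurrence i))) ⟩
    b * ((B * x - σ B * y) - (B * z - σ B * w))
      ≈⟨ solve 7 (λ b B S x y z w → b :* ((B :* x :- S :* y) :- (B :* z :- S :* w))
             := B :* (b :* (x :- z)) :- S :* (b :* (y :- w)))
           refl b B (σ B) x y z w ⟩
    B * (b * (x - z)) - σ B * (b * (y - w))
      ≈⟨ +-cong (*-congˡ (σ-chain (suc i))) (-‿cong (*-congˡ (begin
           σ (σ (γ (suc (suc i))))                     ≈⟨ σ-cong (σ-chain i) ⟩
           σ (β (suc i) * (σ (γ (suc i)) - σ (γ i)))   ≈⟨ σ-* _ _ ⟩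
           σ (β (suc i)) * σ (σ (γ (suc i)) - σ (γ i)) ≈⟨ *-cong (σ-β (suc i)) (σ-sub _ _) ⟩
           b * (y - w)                                 ∎))) ⟨
    B * σ (γ (suc (suc (suc i)))) - σ B * σ (σ (γ (suc (suc i)))) ∎
    where
    b = β (suc (suc i))
    x = σ (γ (suc (suc i)))
    y = σ (σ (γ (suc i)))
    z = σ (γ (suc i))
    w = σ (σ (γ i))

  -- The (k+1)-fold iterate of the Möbius transformation is the identity once its
  -- entry γ (k+1) vanishes.
  γ≈0⇒γ≈δ : ∀ k → (∀ {x y} → B * x ≈ B * y → x ≈ y) → β (suc k) ≈ B →
    γ (suc k) ≈ 0# → γ (suc (suc k)) ≈ δ (suc k)
  γ≈0⇒γ≈δ k B-cancel periodic γ≈0 = begin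
    γ (suc (suc k))                          ≈⟨ γ-next ⟩
    -- As this element is fixed by `σ`, the map may be applied to it; it turns `β k` into
    -- `β (suc k)`, which is `B`, and so produces the expression of `δ≈σγ`.
    - (β k * γ k)                            ≈⟨ fixed ⟩
    σ (- (β k * γ k))                        ≈⟨ σ-neg _ ⟩
    - σ (β k * γ k)
      ≈⟨ -‿cong (trans (σ-* _ _) (*-congʳ (trans (σ-β k) periodic))) ⟩
    - (B * σ (γ k))                          ≈⟨ δ≈σγ k ⟨
    δ (suc k)                                ∎
    where
    γ-next : γ (suc (suc k)) ≈ - (β k * γ k)
    γ-next = trans (*-congˡ (+-congʳ γ≈0))
      (solve 2 (λ b x → b :* (:0 :- x) := :- (b :* x)) refl (β k) (γ k))
    -- The next continuant is computed from both ends: its definition gives `B * γ (suc (suc k))`,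
    -- the left recurrence gives `B * σ (γ (suc (suc k)))`.
    σ-fixed : γ (suc (suc k)) ≈ σ (γ (suc (suc k)))
    σ-fixed = B-cancel (begin
      B * γ (suc (suc k))
        ≈⟨ solve 2 (λ b x → b :* x := b :* (x :- :0)) refl B _ ⟩
      B * (γ (suc (suc k)) - 0#)
        ≈⟨ *-cong periodic (+-congˡ (-‿cong γ≈0)) ⟨
      γ (suc (suc (suc k)))
        ≈⟨ γ-left-recurrence (suc k) ⟩
      B * σ (γ (suc (suc k))) - σ B * σ (σ (γ (suc k)))
        ≈⟨ +-congˡ (-‿cong (*-congˡ (trans (σ-cong (trans (σ-cong γ≈0) σ-0#)) σ-0#))) ⟩
      B * σ (γ (suc (suc k))) - σ B * 0#
        ≈⟨ solve 2 (λ x y → x :- y :* :0 := x) refl _ (σ B) ⟩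
      B * σ (γ (suc (suc k))) ∎)
    fixed : - (β k * γ k) ≈ σ (- (β k * γ k))
    fixed = trans (sym γ-next) (trans σ-fixed (σ-cong γ-next))

  ∏β : ℕ → Carrier
  ∏β zero    = 1#
  ∏β (suc i) = β i * ∏β i

  -- Since `B * x ≈ 1#`, the power x^(q^i) is inverse to `β i`; dividing the recurrence of `γ` by
  -- the product `∏β` therefore yields that of `P`.
  γ≈∏β*P : ∀ {x} → B * x ≈ 1# → ∀ i → γ (suc i) ≈ ∏β i * P q (suc i) x
  γ≈∏β*P Bx≈1 zero       = sym (*-identityˡ 1#)
  γ≈∏β*P Bx≈1 (suc zero) = solve 1 (λ b → b :* (:1 :- :0) := b :* :1 :* :1) refl (β 0)
  γ≈∏β*P {x} Bx≈1 (suc (suc i)) = begin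
    β (suc i) * (γ (suc (suc i)) - γ (suc i))
      ≈⟨ *-congˡ (+-cong (γ≈∏β*P Bx≈1 (suc i)) (-‿cong (γ≈∏β*P Bx≈1 i))) ⟩
    β (suc i) * (β i * ∏β i * p₂ - ∏β i * p₁)
      ≈⟨ *-congˡ (+-congˡ (-‿cong (begin
           ∏β i * p₁                ≈⟨ *-identityˡ _ ⟨
           1# * (∏β i * p₁)         ≈⟨ *-congʳ (begin
               1#                   ≈⟨ pow-1# (q ℕ.^ i) ⟨
               pow 1# (q ℕ.^ i)     ≈⟨ pow-cong (q ℕ.^ i) Bx≈1 ⟨
               pow (B * x) (q ℕ.^ i) ≈⟨ pow-distrib-* B x (q ℕ.^ i) ⟩
               β i * X              ∎) ⟩
           β i * X * (∏β i * p₁)    ∎))) ⟩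
    β (suc i) * (β i * ∏β i * p₂ - β i * X * (∏β i * p₁))
      ≈⟨ solve 6 (λ b b′ p x y z → b :* (b′ :* p :* y :- b′ :* x :* (p :* z)) := b :* (b′ :* p) :* (y :- x :* z))
           refl (β (suc i)) (β i) (∏β i) X p₂ p₁ ⟩
    ∏β (suc (suc i)) * (p₂ - X * p₁) ∎
    where
    X  = pow x (q ℕ.^ i)
    p₁ = P q (suc i) x
    p₂ = P q (suc (suc i)) x

-- Splitting over the field of order q^(k+1) forces a zero of `γ`

module Bluher {c ℓ} (F : CommutativeRing c ℓ) (isField : IsField F) (e : ℕ) (k : ℕ)
              (hasOrder : HasOrder F (suc (suc e) ^ suc k))
              (frob : Sequences.Frobenius F (suc (suc e)))
              (B : CommutativeRing.Carrier F)
              (B≉0 : ¬ (CommutativeRing._≈_ F B (CommutativeRing.0# F))) where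
  open CommutativeRing F hiding (zero)
  open IsField isField
  open Poly F
  open Sequences F
  open LinearProducts F
  open FieldProperties F isField
  open Factorisation F isField
  open FiniteField F isField hasOrder
  open GroupProperties +-group using (x∙y⁻¹≈ε⇒x≈y)
  open Multiples semiring using () renaming (_×_ to _·_)
  open Solver F using (solve; _:+_; _:*_; _:-_; _:=_; :-_; :0; :1)
  open SetoidReasoning setoid

  q : ℕ
  q = suc (suc e)

  open Chains F q frob B

  N : ℕ
  N = q ^ suc k

  q≤N : q ≤ N
  q≤N = ≡.subst (_≤ N) (ℕₚ.^-identityʳ q) (ℕₚ.^-monoʳ-≤ q (s≤s (z≤n {k})))

  β-periodic : β (suc k) ≈ B
  β-periodic = pow-order (ℕₚ.≤-trans (s≤s z≤n) q≤N) B

  β≉0 : ∀ i → ¬ (β i ≈ 0#)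
  β≉0 i = pow-nonzero (q ^ i) B≉0

  ∏β≉0 : ∀ i → ¬ (∏β i ≈ 0#)
  ∏β≉0 zero    = 1≉0
  ∏β≉0 (suc i) = *-nonzero (β≉0 i) (∏β≉0 i)

  -- The factors `β i` are nonzero, so the recurrence runs backwards and two adjacent zeros would
  -- propagate down to `γ 1`, which is `1#`.
  γ-zeros-isolated : ∀ i → γ i ≈ 0# → ¬ (γ (suc i) ≈ 0#)
  γ-zeros-isolated zero    _     γ₁≈0 = 1≉0 γ₁≈0
  γ-zeros-isolated (suc i) γ₁≈0 γ₂≈0 = γ-zeros-isolated i
    (trans (sym (x∙y⁻¹≈ε⇒x≈y _ _ (x*y≈0⇒y≈0 (β≉0 i) γ₂≈0))) γ₁≈0) γ₁≈0

  pair-FB : ∀ s → pair (suc q) (FB q B) s ≈ s (suc q) + - B * s 1 + B * s 0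
  pair-FB s = trans (pair-cong (suc q) {s = s} (FB≈trinomial (suc e) B) (λ _ → refl))
    (pair-trinomial (suc e) (- B) B s)

  Root-FB : Carrier → Set ℓ
  Root-FB = Root (suc q) (FB q B)

  root⇒solution : ∀ {r} → Root-FB r → Solution (pow r)
  root⇒solution {r} root n = begin
    pow r (suc q ℕ.+ n)
      ≈⟨ pow-+ r (suc q) n ⟩
    pow r (suc q) * pow r n
      ≈⟨ solve 4 (λ x b r y → x :* y := (x :+ :- b :* (r :* :1) :+ b :* :1) :* y :+ (b :* (r :* y) :+ :- b :* y))
           refl (pow r (suc q)) B r (pow r n) ⟩
    (pow r (suc q) + - B * (r * 1#) + B * 1#) * pow r n + (B * (r * pow r n) + - B * pow r n)
      ≈⟨ +-congʳ (*-congʳ (trans (sym (pair-FB (pow r))) root)) ⟩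
    0# * pow r n + (B * (r * pow r n) + - B * pow r n)
      ≈⟨ solve 2 (λ x y → :0 :* x :+ y := y) refl _ _ ⟩
    B * (r * pow r n) + - B * pow r n ∎

  -- `solution-chain` for `pow r` at `suc k` and index 0, where r^N = r turns r^(N+1) and r^N into r
  -- * r and r.
  root⇒quadratic : ∀ {r} → Root-FB r →
    γ (suc k) * (r * r) + (δ (suc k) - γ (suc (suc k))) * r - δ (suc (suc k)) ≈ 0#
  root⇒quadratic {r} root = begin
    g * (r * r) + (d - g′) * r - d′
      ≈⟨ solve 5 (λ g d g′ d′ r → g :* (r :* r) :+ (d :- g′) :* r :- d′
             := (g :* (r :* r) :+ d :* r) :- (g′ :* (r :* :1) :+ d′ :* :1)) refl g d g′ d′ r ⟩
    (g * (r * r) + d * r) - (g′ * (r * 1#) + d′ * 1#)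
      ≈⟨ +-congʳ (begin
           g * pow r (N ℕ.+ 1) + d * pow r (N ℕ.+ 0)
             ≡⟨ ≡.cong₂ (λ i j → g * pow r i + d * pow r j) (ℕₚ.+-comm N 1) (ℕₚ.+-identityʳ N) ⟩
           g * (r * pow r N) + d * pow r N
             ≈⟨ +-cong (*-congˡ (*-congˡ frobenius-fixed)) (*-congˡ frobenius-fixed) ⟩
           g * (r * r) + d * r ∎) ⟨
    (g * pow r (N ℕ.+ 1) + d * pow r (N ℕ.+ 0)) - (g′ * (r * 1#) + d′ * 1#)
      ≈⟨ +-congʳ (solution-chain (pow r) (root⇒solution root) (suc k) 0) ⟩
    (g′ * (r * 1#) + d′ * 1#) - (g′ * (r * 1#) + d′ * 1#)
      ≈⟨ -‿inverseʳ _ ⟩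
    0# ∎
    where
    g  = γ (suc k)
    d  = δ (suc k)
    g′ = γ (suc (suc k))
    d′ = δ (suc (suc k))
    frobenius-fixed : pow r N ≈ r
    frobenius-fixed = pow-order (ℕₚ.≤-trans (s≤s z≤n) q≤N) r

  -- Divided differences: the secants through x, y and through x, z have slope zero, and the
  -- difference of the two slopes is (y - z) * a.
  quadratic-3-roots : ∀ {a m l x y z} → ¬ (x ≈ y) → ¬ (x ≈ z) → ¬ (y ≈ z) →
    a * (x * x) + m * x - l ≈ 0# → a * (y * y) + m * y - l ≈ 0# → a * (z * z) + m * z - l ≈ 0# →
    a ≈ 0#
  quadratic-3-roots {a} {m} {l} {x} {y} {z} x≉y x≉z y≉z fx fy fz =
    x*y≈0⇒y≈0 (x-y≉0 y≉z) (begin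
      (y - z) * a
        ≈⟨ solve 5 (λ a m x y z → (y :- z) :* a := (a :* (x :+ y) :+ m) :- (a :* (x :+ z) :+ m)) refl a m x y z ⟩
      (a * (x + y) + m) - (a * (x + z) + m)
        ≈⟨ +-cong (secant x≉y fx fy) (-‿cong (secant x≉z fx fz)) ⟩
      0# - 0#
        ≈⟨ -‿inverseʳ 0# ⟩
      0# ∎)
    where
    secant : ∀ {u v} → ¬ (u ≈ v) → a * (u * u) + m * u - l ≈ 0# → a * (v * v) + m * v - l ≈ 0# →
             a * (u + v) + m ≈ 0#
    secant {u} {v} u≉v fu fv = x*y≈0⇒y≈0 (x-y≉0 u≉v) (begin
      (u - v) * (a * (u + v) + m)
        ≈⟨ solve 5 (λ a m l u v → (u :- v) :* (a :* (u :+ v) :+ m)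
               := (a :* (u :* u) :+ m :* u :- l) :- (a :* (v :* v) :+ m :* v :- l)) refl a m l u v ⟩
      (a * (u * u) + m * u - l) - (a * (v * v) + m * v - l)
        ≈⟨ +-cong fu (-‿cong fv) ⟩
      0# - 0#
        ≈⟨ -‿inverseʳ 0# ⟩
      0# ∎)

  module _ (q·1≈0 : q · 1# ≈ 0#) (rs : List Carrier) (length≡ : length rs ≡ suc q)
           (split : ∀ n → linProd rs n ≈ FB q B n) where

    pair-split : ∀ s → pair (suc q) (FB q B) s ≈ Δ* rs s 0
    pair-split s = begin
      pair (suc q) (FB q B) s        ≈⟨ pair-cong (suc q) {s = s} split (λ _ → refl) ⟨
      pair (suc q) (linProd rs) s    ≡⟨ ≡.cong (λ d → pair d (linProd rs) s) length≡ ⟨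
      pair (length rs) (linProd rs) s  ≈⟨ pair-linProd rs s ⟩
      Δ* rs s 0                      ∎

    factor-root : ∀ {r} → Any (r ≈_) rs → Root-FB r
    factor-root {r} r∈rs = trans (pair-split (pow r))
      (Δ*-geometric rs {r} {1#} (pow r) r∈rs (λ n → sym (*-identityˡ _)) 0)

    -- Pairing F_B with n r^n gives r F_B'(r), and F_B(r) - r F_B'(r) = B - q r^(q+1), which is B as
    -- q vanishes in the field. At a multiple root the left side is zero.
    no-multiple-roots : ∀ {r} → Any (r ≈_) rs → ¬ Twice r rs
    no-multiple-roots {r} r∈rs twice = B≉0 (begin
      B
        ≈⟨ solve 4 (λ x b r m → b := (x :+ :- b :* (r :* :1) :+ b :* :1) :+ m :* x
               :- ((:1 :+ m) :* x :+ :- b :* ((:1 :+ :0) :* (r :* :1)) :+ b :* (:0 :* :1)))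
             refl (pow r (suc q)) B r (q · 1#) ⟩
      (pow r (suc q) + - B * (r * 1#) + B * 1#) + q · 1# * pow r (suc q)
        - ((1# + q · 1#) * pow r (suc q) + - B * ((1# + 0#) * (r * 1#)) + B * (0# * 1#))
        ≈⟨ +-cong (+-cong (trans (sym (pair-FB (pow r))) (factor-root r∈rs)) (*-congʳ q·1≈0))
             (-‿cong (trans (sym (pair-FB s)) (trans (pair-split s) s-annihilated))) ⟩
      0# + 0# * pow r (suc q) - 0#
        ≈⟨ solve 1 (λ x → :0 :+ :0 :* x :- :0 := :0) refl _ ⟩
      0# ∎)
      where
      s : Sequence
      s n = n · 1# * pow r n
      s-annihilated : Δ* rs s 0 ≈ 0#
      s-annihilated = Δ*-twice rs {r} {1#} {0#} s twice
        (λ n → solve 2 (λ m x → m :* x := (m :* :1 :+ :0) :* x) refl (n · 1#) (pow r n)) 0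

  splits⇒γ≈0 : q · 1# ≈ 0# → SplitsCompletely (suc q) (FB q B) → γ (suc k) ≈ 0#
  -- As `q` is e + 2, `length≡` excludes lists with fewer than three entries.
  splits⇒γ≈0 q·1≈0 (rs@(x ∷ y ∷ z ∷ _) , length≡ , split) = quadratic-3-roots
    (λ x≈y → simple (here refl) (here refl (here x≈y)))
    (λ x≈z → simple (here refl) (here refl (there (here x≈z))))
    (λ y≈z → simple (there (here refl)) (there (here refl (here y≈z))))
    (root⇒quadratic (root (here refl)))
    (root⇒quadratic (root (there (here refl))))
    (root⇒quadratic (root (there (there (here refl)))))
    where
    root : ∀ {r} → Any (r ≈_) rs → Root-FB r
    root = factor-root q·1≈0 rs length≡ split
    simple : ∀ {r} → Any (r ≈_) rs → ¬ Twice r rs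
    simple = no-multiple-roots q·1≈0 rs length≡ split

  -- The converse: the impulse response and a count of roots

  -- The entries n, ..., n + q of the solution with initial values 0, ..., 0, 1.
  window : ℕ → Sequence
  window zero i with i ℕ.<? q
  ... | yes _ = 0#
  ... | no  _ = 1#
  window (suc n) i with i ℕ.<? q
  ... | yes _ = window n (suc i)
  ... | no  _ = B * window n 1 + - B * window n 0

  impulse : Sequence
  impulse n = window n 0

  window-shift : ∀ n i → i < q → window (suc n) i ≈ window n (suc i)
  window-shift n i i<q with i ℕ.<? q
  ... | yes _   = refl
  ... | no  i≮q = contradiction i<q i≮q

  window-end : ∀ n → window (suc n) q ≈ B * window n 1 + - B * window n 0
  window-end n with q ℕ.<? q
  ... | yes q<q = contradiction q<q (ℕₚ.<-irrefl ≡.refl)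
  ... | no  _   = refl

  -- Each step slides the entries down by one place, so entry `i` reaches the front after `i` steps.
  -- The bound matters: position `q` holds the newest value.
  window≈impulse : ∀ i n → i ≤ q → window n i ≈ impulse (i ℕ.+ n)
  window≈impulse zero    n _   = refl
  window≈impulse (suc i) n i<q = begin
    window n (suc i)         ≈⟨ window-shift n i i<q ⟨
    window (suc n) i         ≈⟨ window≈impulse i (suc n) (ℕₚ.<⇒≤ i<q) ⟩
    impulse (i ℕ.+ suc n)    ≡⟨ ≡.cong impulse (ℕₚ.+-suc i n) ⟩
    impulse (suc i ℕ.+ n)    ∎

  impulse-solution : Solution impulse
  impulse-solution n = begin
    impulse (suc q ℕ.+ n)       ≡⟨ ≡.cong impulse (ℕₚ.+-suc q n) ⟨
    impulse (q ℕ.+ suc n)       ≈⟨ window≈impulse q (suc n) ℕₚ.≤-refl ⟨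
    window (suc n) q            ≈⟨ window-end n ⟩
    B * window n 1 + - B * window n 0
                                ≈⟨ +-congʳ (*-congˡ (window≈impulse 1 n (s≤s z≤n))) ⟩
    B * impulse (1 ℕ.+ n) + - B * impulse n ∎

  impulse-low : ∀ i → i < q → impulse i ≈ 0#
  impulse-low i i<q = begin
    impulse i          ≡⟨ ≡.cong impulse (ℕₚ.+-identityʳ i) ⟨
    impulse (i ℕ.+ 0)  ≈⟨ window≈impulse i 0 (ℕₚ.<⇒≤ i<q) ⟨
    window 0 i         ≈⟨ initial ⟩
    0#                 ∎
    where
    initial : window 0 i ≈ 0#
    initial with i ℕ.<? q
    ... | yes _   = refl
    ... | no  i≮q = contradiction i<q i≮q

  impulse-top : impulse q ≈ 1#
  impulse-top = begin
    impulse q          ≡⟨ ≡.cong impulse (ℕₚ.+-identityʳ q) ⟨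
    impulse (q ℕ.+ 0)  ≈⟨ window≈impulse q 0 ℕₚ.≤-refl ⟨
    window 0 q         ≈⟨ initial ⟩
    1#                 ∎
    where
    initial : window 0 q ≈ 1#
    initial with q ℕ.<? q
    ... | yes q<q = contradiction q<q (ℕₚ.<-irrefl ≡.refl)
    ... | no  _   = refl

  -- In `solution-chain` at `suc k` the first coefficient vanishes, and by `δ≈σγ` so does the last.
  -- The other two are equal by `γ≈0⇒γ≈δ` and nonzero because zeros of `γ` are isolated, hence
  -- cancel.
  γ≈0⇒periodic : γ (suc k) ≈ 0# → ∀ s → Solution s → ∀ n → s (N ℕ.+ n) ≈ s (suc n)
  γ≈0⇒periodic γ≈0 s solution n = *-cancelˡ-nonzero (γ-zeros-isolated (suc k) γ≈0) (begin
    g′ * s (N ℕ.+ n)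
      ≈⟨ *-congʳ (γ≈0⇒γ≈δ k (*-cancelˡ-nonzero B≉0) β-periodic γ≈0) ⟩
    d * s (N ℕ.+ n)
      ≈⟨ solve 3 (λ d x y → d :* x := :0 :* y :+ d :* x) refl d _ _ ⟩
    0# * s (N ℕ.+ suc n) + d * s (N ℕ.+ n)
      ≈⟨ +-congʳ (*-congʳ γ≈0) ⟨
    γ (suc k) * s (N ℕ.+ suc n) + d * s (N ℕ.+ n)
      ≈⟨ solution-chain s solution (suc k) n ⟩
    g′ * s (suc n) + δ (suc (suc k)) * s n
      ≈⟨ +-congˡ (*-congʳ (trans (δ≈σγ (suc k)) (-‿cong (*-congˡ (trans (σ-cong γ≈0) σ-0#))))) ⟩
    g′ * s (suc n) + - (B * 0#) * s n
      ≈⟨ solve 4 (λ g x b y → g :* x :+ :- (b :* :0) :* y := g :* x) refl g′ (s (suc n)) B (s n) ⟩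
    g′ * s (suc n) ∎)
    where
    g′ = γ (suc (suc k))
    d  = δ (suc k)

  -- The hypothesis says that T^N - T kills `s`, and X^N - X is the product of X - a over all field
  -- elements. Index 0 is the essential case, as the shifted sequence satisfies the hypothesis
  -- again.
  periodic⇒annihilated : ∀ s → (∀ n → s (N ℕ.+ n) ≈ s (suc n)) → ∀ n → Δ* elements s n ≈ 0#
  periodic⇒annihilated s periodic (suc n) =
    trans (reflexive (≡.sym (Δ*-shift elements s n)))
      (periodic⇒annihilated (s ∘ suc)
        (λ i → trans (reflexive (≡.cong s (≡.sym (ℕₚ.+-suc N i)))) (periodic (suc i))) n)
  periodic⇒annihilated s periodic zero
    -- Writing `N` as e′ + 2 brings X^N - X into the shape of `trinomial`.
    with ℕₚ.m≤n⇒∃[o]m+o≡n (ℕₚ.≤-trans (s≤s (s≤s (z≤n {e}))) q≤N)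
  ... | e′ , 2+e′≡N = begin
    Δ* elements s 0
      ≈⟨ pair-linProd elements s ⟨
    pair (length elements) (linProd elements) s
      ≈⟨ pair-cong (length elements) {s = s} linProd-elements (λ _ → refl) ⟩
    pair (length elements) f s
      ≡⟨ ≡.cong (λ d → pair d f s) length≡ ⟩
    pair (suc (suc e′)) f s
      ≈⟨ pair-trinomial e′ (- 1#) 0# s ⟩
    s (suc (suc e′)) + - 1# * s 1 + 0# * s 0
      ≈⟨ +-congʳ (+-congʳ (trans (reflexive (≡.cong s (≡.trans 2+e′≡N (≡.sym (ℕₚ.+-identityʳ N))))) (periodic 0))) ⟩
    s 1 + - 1# * s 1 + 0# * s 0
      ≈⟨ solve 2 (λ x y → x :+ :- :1 :* x :+ :0 :* y := :0) refl _ _ ⟩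
    0# ∎
    where
    f = trinomial e′ (- 1#) 0#
    length≡ : length elements ≡ suc (suc e′)
    length≡ = ≡.trans length-elements (≡.sym 2+e′≡N)
    f-root : ∀ x → Root (suc (suc e′)) f x
    f-root x = begin
      pair (suc (suc e′)) f (pow x)
        ≈⟨ pair-trinomial e′ (- 1#) 0# (pow x) ⟩
      pow x (suc (suc e′)) + - 1# * (x * 1#) + 0# * 1#
        ≈⟨ +-congʳ (+-congʳ (trans (reflexive (≡.cong (pow x) 2+e′≡N)) (pow-order (ℕₚ.≤-trans (s≤s z≤n) q≤N) x))) ⟩
      x + - 1# * (x * 1#) + 0# * 1#
        ≈⟨ solve 1 (λ x → x :+ :- :1 :* (x :* :1) :+ :0 :* :1 := :0) refl x ⟩
      0# ∎
    linProd-elements : ∀ n → linProd elements n ≈ f n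
    linProd-elements = monic⇒linProd elements f
      (λ n d<n → trinomial-above e′ (- 1#) 0# n (≡.subst (_< n) length≡ d<n))
      (trans (reflexive (≡.cong f length≡)) (trinomial-top e′ (- 1#) 0#))
      elements-unique
      (All.universal (λ x → ≡.subst (λ d → Root d f x) (≡.sym length≡) (f-root x)) elements)

  Δ-solution : ∀ r s → Solution s → Solution (Δ r s)
  Δ-solution r s solution n = begin
    s (suc (suc q ℕ.+ n)) - r * s (suc q ℕ.+ n)
      ≡⟨ ≡.cong (λ i → s (suc i) - r * s (suc q ℕ.+ n)) (ℕₚ.+-suc q n) ⟨
    s (suc q ℕ.+ suc n) - r * s (suc q ℕ.+ n)
      ≈⟨ +-cong (solution (suc n)) (-‿cong (*-congˡ (solution n))) ⟩
    (B * s (suc (suc n)) + - B * s (suc n)) - r * (B * s (suc n) + - B * s n)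
      ≈⟨ solve 5 (λ b r x y z → (b :* x :+ :- b :* y) :- r :* (b :* y :+ :- b :* z)
             := b :* (x :- r :* y) :+ :- b :* (y :- r :* z))
           refl B r (s (suc (suc n))) (s (suc n)) (s n) ⟩
    B * Δ r s (suc n) + - B * Δ r s n ∎

  Δ*-solution : ∀ rs s → Solution s → Solution (Δ* rs s)
  Δ*-solution []       s solution = solution
  Δ*-solution (r ∷ rs) s solution = Δ*-solution rs (Δ r s) (Δ-solution r s solution)

  -- If T - r kills `s`, then `s` is geometric of ratio `r`, and the recurrence reads F_B(r) s(n) =
  -- 0 with a nonzero first factor.
  Δ-injective-off-roots : ∀ {r} s → ¬ Root-FB r → Solution s →
    (∀ n → Δ r s n ≈ 0#) → ∀ n → s n ≈ 0#
  Δ-injective-off-roots {r} s nonroot solution Δ≈0 n =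
    x*y≈0⇒y≈0 (nonroot ∘ trans (pair-FB (pow r))) (begin
      (pow r (suc q) + - B * (r * 1#) + B * 1#) * s n
        ≈⟨ solve 4 (λ x b r y → (x :+ :- b :* (r :* :1) :+ b :* :1) :* y
               := x :* y :- (b :* ((r :* :1) :* y) :+ :- b :* y)) refl (pow r (suc q)) B r (s n) ⟩
      pow r (suc q) * s n - (B * (r * 1# * s n) + - B * s n)
        ≈⟨ +-cong (geometric (suc q)) (-‿cong (+-congʳ (*-congˡ (geometric 1)))) ⟨
      s (suc q ℕ.+ n) - (B * s (suc n) + - B * s n)
        ≈⟨ +-congʳ (solution n) ⟩
      (B * s (suc n) + - B * s n) - (B * s (suc n) + - B * s n)
        ≈⟨ -‿inverseʳ _ ⟩
      0# ∎)
    where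
    geometric : ∀ m → s (m ℕ.+ n) ≈ pow r m * s n
    geometric zero    = sym (*-identityˡ _)
    geometric (suc m) = begin
      s (suc (m ℕ.+ n))    ≈⟨ x∙y⁻¹≈ε⇒x≈y _ _ (Δ≈0 (m ℕ.+ n)) ⟩
      r * s (m ℕ.+ n)      ≈⟨ *-congˡ (geometric m) ⟩
      r * (pow r m * s n)  ≈⟨ *-assoc r _ _ ⟨
      r * pow r m * s n    ∎

  Root-FB? : U.Decidable Root-FB
  Root-FB? r = pair (suc q) (FB q B) (pow r) ≟ 0#

  filter-annihilated : ∀ rs s → Solution s → (∀ n → Δ* rs s n ≈ 0#) →
    ∀ n → Δ* (filter Root-FB? rs) s n ≈ 0#
  filter-annihilated []       s solution Δ*≈0 = Δ*≈0
  filter-annihilated (r ∷ rs) s solution Δ*≈0 with Root-FB? r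
  ... | yes root    rewrite List.filter-accept Root-FB? {xs = rs} root =
    filter-annihilated rs (Δ r s) (Δ-solution r s solution) Δ*≈0
  ... | no  nonroot rewrite List.filter-reject Root-FB? {xs = rs} nonroot =
    -- The operator `Δ r` is moved to the outside by `Δ*-comm`, where injectivity on solutions
    -- removes it.
    filter-annihilated rs s solution
      (Δ-injective-off-roots (Δ* rs s) nonroot (Δ*-solution rs s solution)
        (λ n → trans (sym (Δ*-comm rs r s n)) (Δ*≈0 n)))

  γ≈0⇒splits : γ (suc k) ≈ 0# → SplitsCompletely (suc q) (FB q B)
  γ≈0⇒splits γ≈0 = rs , length≡ ,
    monic⇒linProd rs (FB q B)
      (λ n d<n → trans (FB≈trinomial (suc e) B n)
        (trinomial-above (suc e) (- B) B n (≡.subst (_< n) length≡ d<n)))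
      (trans (reflexive (≡.cong (FB q B) length≡))
        (trans (FB≈trinomial (suc e) B (suc q)) (trinomial-top (suc e) (- B) B)))
      (Unique.take⁺ setoid (suc q) (Unique.filter⁺ setoid Root-FB? elements-unique))
      (≡.subst (λ d → All (Root d (FB q B)) rs) (≡.sym length≡)
        (All.take⁺ (suc q) (All.all-filter Root-FB? elements)))
    where
    roots : List Carrier
    roots = filter Root-FB? elements
    roots-annihilate : ∀ n → Δ* roots impulse n ≈ 0#
    roots-annihilate = filter-annihilated elements impulse impulse-solution
      (periodic⇒annihilated impulse (γ≈0⇒periodic γ≈0 impulse impulse-solution))
    -- With at most `q` roots, the product over them would by `Δ*-impulse` leave the value `1#` at
    -- some index of a sequence that is zero.
    enough-roots : suc q ≤ length roots
    enough-roots with suc q ℕ.≤? length roots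
    ... | yes q<d = q<d
    ... | no  q≮d = contradiction
      (trans (sym (Δ*-impulse roots q impulse (ℕₚ.≤-pred (ℕₚ.≰⇒> q≮d)) impulse-low impulse-top))
        (roots-annihilate (q ∸ length roots))) 1≉0
    rs : List Carrier
    -- Any `suc q` distinct roots determine a monic polynomial of this degree.
    rs = take (suc q) roots
    length≡ : length rs ≡ suc q
    length≡ = ≡.trans (List.length-take (suc q) roots) (ℕₚ.m≤n⇒m⊓n≡m enough-roots)

  -- The product `∏β k` is a unit, so `γ (suc k)` vanishes together with the value of `P` at the
  -- inverse of `B`.
  splits⇔P≈0 : q · 1# ≈ 0# → SplitsCompletely (suc q) (FB q B) ⇔
    (∃ λ B⁻¹ → (B * B⁻¹ ≈ 1#) × (P q (suc k) B⁻¹ ≈ 0#))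
  splits⇔P≈0 q·1≈0 = mk⇔
    (λ splits → let (B⁻¹ , BB⁻¹≈1) = inverse B B≉0 in
      B⁻¹ , BB⁻¹≈1 , x*y≈0⇒y≈0 (∏β≉0 k) (trans (sym (γ≈∏β*P BB⁻¹≈1 k)) (splits⇒γ≈0 q·1≈0 splits)))
    (λ (B⁻¹ , BB⁻¹≈1 , P≈0) →
      γ≈0⇒splits (trans (γ≈∏β*P BB⁻¹≈1 k) (trans (*-congˡ P≈0) (zeroʳ _))))

-- Specialisation to a prime power q

prime-power≥2 : ∀ {p m} → Prime p → 1 ≤ m → 2 ≤ p ^ m
prime-power≥2 {p} {m} p-prime 1≤m = ℕₚ.≤-trans (ℕ.nonTrivial⇒n>1 p {{prime⇒nonTrivial p-prime}})
  (≡.subst (_≤ p ^ m) (ℕₚ.^-identityʳ p) (ℕₚ.^-monoʳ-≤ p {{prime⇒nonZero p-prime}} 1≤m))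

theorem3 : ∀ {c ℓ} (p m q k : ℕ) → Prime p → 1 ≤ m → q ≡ p ^ m → 3 ≤ k →
    (F : CommutativeRing c ℓ) → IsField F → HasOrder F (q ^ k) →
    let module R = CommutativeRing F
        module Pl = Poly F
    in (B : R.Carrier) → ¬ (B R.≈ R.0#) →
       (Pl.SplitsCompletely (suc q) (Pl.FB q B)
         ⇔ (∃ λ Binv → (B R.* Binv R.≈ R.1#) × (Pl.P q k Binv R.≈ R.0#)))
theorem3 p m zero k p-prime 1≤m q≡p^m 3≤k F isField hasOrder B B≉0 =
  contradiction (≡.subst (2 ≤_) (≡.sym q≡p^m) (prime-power≥2 p-prime 1≤m)) λ ()
theorem3 p m (suc zero) k p-prime 1≤m q≡p^m 3≤k F isField hasOrder B B≉0 =
  contradiction (≡.subst (2 ≤_) (≡.sym q≡p^m) (prime-power≥2 p-prime 1≤m)) λ { (s≤s ()) }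
theorem3 p m q@(suc (suc e)) (suc k) p-prime 1≤m q≡p^m 3≤k F isField hasOrder B B≉0 =
  Bluher.splits⇔P≈0 F isField e k hasOrder frob B B≉0 q·1≈0
  where
  open CommutativeRing F using (_≈_; 0#; 1#; semiring)
  open Sequences F using (Frobenius; frobenius-^; frobenius-prime)
  open FiniteField F isField hasOrder using (order·1≈0; n^j·1≈0⇒n·1≈0)
  open Multiples semiring using () renaming (_×_ to _·_)
  q·1≈0 : q · 1# ≈ 0#
  q·1≈0 = n^j·1≈0⇒n·1≈0 q (suc k) order·1≈0
  frob : Frobenius q
  -- The principle for the prime characteristic `p` is iterated `m` times.
  frob = ≡.subst Frobenius (≡.sym q≡p^m)
    (frobenius-^ (frobenius-prime p-prime
      (n^j·1≈0⇒n·1≈0 p m (≡.subst (λ n → n · 1# ≈ 0#) q≡p^m q·1≈0))) m)
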